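{- Let $n\ge1$. If $\mathcal F_n\equiv\widehat{\mathcal F_n}$ (elementary equivalence in the language of Heyting algebras), then $\mathcal F_n\preccurlyeq\widehat{\mathcal F_n}$ (i.e. $\mathcal F_n$ is an elementary substructure of $\widehat{\mathcal F_n}$).
   Context: Fix $n\ge1$ and symbols $P_1,\dots,P_n$. The partially ordered set $(K_n,\le)$ with valuation map $\mathrm{val}:K_n\to\mathfrak P(\{P_1,\dots,P_n\})$ is the increasing union of finite sets $K_n^d$ ($d\ge 0$) built recursively: $K_n^{ -1}=\emptyset$, and $K_n^d\setminus K_n^{d-1}$ consists of exactly one point $w_{\beta,Y}$ for each pair $(\beta,Y)$ such that (i) $Y$ is a decreasing subset of $K_n^{d-1}$ with $Y\not\subseteq K_n^{d-2}$ (for $d=0$ this last condition is void, so $Y=\emptyset$); (ii) $\beta\subseteq\{P_1,\dots,P_n\}$ and $\beta\subseteq\mathrm{val}(w')$ for all $w'\in Y$; (iii) if $Y$ is the decreasing set generated by a single element $w_{\beta',Y'}$, then $\beta\ne\beta'$. One sets $\mathrm{val}(w_{\beta,Y})=\beta$, and $w\le w_{\beta,Y}$ iff $w\in Y$ or $w=w_{\beta,Y}$. $\widehat{\mathcal F_n}:=\mathcal O_\downarrow(K_n,\le)$ is the Heyting algebra of all decreasing subsets of $K_n$ ($\sqcap=\cap$, $\sqcup=\cup$, $a\to b$ = the largest decreasing set contained in $(K_n\setminus a)\cup b$). By a theorem of Bellissima, the Heyting sub-algebra of $\widehat{\mathcal F_n}$ generated by $g_i=\{w\in K_n: P_i\in\mathrm{val}(w)\}$,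 $i=1,\dots,n$, is free on $g_1,\dots,g_n$; the free Heyting algebra $\mathcal F_n$ is identified with it. The language of Heyting algebras is $\mathcal L_{HA}=\{0,1,\sqcap,\sqcup,\to\}$. -}

module Defs where

open import Data.Fin.Base using (Fin)
import Data.Fin.Subset as Sub
open import Data.Fin.Subset using (Subset)
open import Data.List.Base using (List; []; _∷_)
open import Data.List.Relation.Unary.All as All using (All; []; _∷_)
open import Data.List.Relation.Unary.Any as Any using (Any; here; there)
open import Data.Nat.Base using (ℕ; zero; suc)
open import Data.Product.Base using (Σ; ∃; _×_; _,_; proj₁; proj₂)
open import Data.Sum.Base using (_⊎_; inj₁; inj₂; [_,_]′)
import Data.Vec.Functional as Env
open Env using (Vector)
import Data.Empty.Polymorphic as Poly
open import Data.Empty using (⊥-elim)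
open import Function.Base using (_∘_; id)
open import Function.Bundles using (_⇔_)
open import Level using (Level; Lift; 0ℓ; _⊔_) renaming (suc to lsuc)
open import Relation.Binary.Bundles using (Poset)
open import Relation.Binary.Lattice.Bundles using (HeytingAlgebra)
open import Relation.Binary.PropositionalEquality.Core using (_≡_; _≢_; refl; subst)
open import Relation.Nullary.Negation.Core using (¬_)
open import Relation.Unary using (Pred; _⊆_; _≐_; ∅; U)

------------------------------------------------------------------------
-- The poset K_n

-- Formal symbols w_{β,Y}.  The list Y stands for the finite set of its
-- members; accordingly symbols are compared by the extensional equality
-- _≈_ below, and the symbols P₁,…,Pₙ are the elements of Fin n.

data Code (n : ℕ) : Set where
  w : (β : Subset n) (Y : List (Code n)) → Code n

module _ {n : ℕ} where

  infix 4 _≈_ _∈_ _≤_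

  val : Code n → Subset n
  val (w β _) = β

  below : Code n → List (Code n)
  below (w _ Y) = Y

  data _≈_ : Code n → Code n → Set where
    w≈ : ∀ {β Y Y′} →
         All (λ y → Any (λ y′ → y ≈ y′) Y′) Y →
         All (λ y′ → Any (λ y → y ≈ y′) Y) Y′ →
         w β Y ≈ w β Y′

  _∈_ : Code n → List (Code n) → Set
  x ∈ Y = Any (x ≈_) Y

  _≤_ : Code n → Code n → Set
  x ≤ c = x ∈ below c ⊎ x ≈ c

  -- Conditions on (β , Y) for w_{β,Y} to be added on top of K, apart from
  -- the requirement that Y is not contained in the stage preceding K.
  record Admissible (K : Pred (Code n) 0ℓ) (β : Subset n) (Y : Pred (Code n) 0ℓ) : Set where
    field
      Y⊆K        : Y ⊆ K
      decreasing : ∀ {x y} → K x → x ≤ y → Y y → Y x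
      β⊆val      : ∀ {y} → Y y → β Sub.⊆ val y
      β≢val      : ∀ {y} → K y → Y ≐ (λ x → K x × x ≤ y) → β ≢ val y

  -- Indices are shifted by one: Stage d is K_n^{d-1}.
  Stage : ℕ → Pred (Code n) 0ℓ
  Stage zero          = ∅
  Stage (suc zero)    c = Admissible (Stage zero) (val c) (_∈ below c)
  Stage (suc (suc d)) c =
    Stage (suc d) c ⊎
    (Admissible (Stage (suc d)) (val c) (_∈ below c) × ¬ ((_∈ below c) ⊆ Stage d))

  InK : Pred (Code n) 0ℓ
  InK c = ∃ λ d → Stage d c

  ≈-refl  : ∀ x → x ≈ x
  ≈-refls : ∀ Y → All (λ y → y ≈ y) Y
  ≈-refl (w β Y) = w≈
    (All.tabulate λ m → Any.map (λ where refl → All.lookup (≈-refls Y) m) m)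
    (All.tabulate λ m → Any.map (λ where refl → All.lookup (≈-refls Y) m) m)
  ≈-refls []      = []
  ≈-refls (y ∷ Y) = ≈-refl y ∷ ≈-refls Y

  ≈-sym   : ∀ {x y} → x ≈ y → y ≈ x
  sym-anyˡ : ∀ {x Y} → Any (λ y → x ≈ y) Y → Any (λ y → y ≈ x) Y
  sym-allˡ : ∀ {X Y} → All (λ x → Any (λ y → x ≈ y) Y) X → All (λ x → Any (λ y → y ≈ x) Y) X
  sym-anyʳ : ∀ {x Y} → Any (λ y → y ≈ x) Y → Any (λ y → x ≈ y) Y
  sym-allʳ : ∀ {X Y} → All (λ x → Any (λ y → y ≈ x) Y) X → All (λ x → Any (λ y → x ≈ y) Y) X
  ≈-sym (w≈ p q) = w≈ (sym-allʳ q) (sym-allˡ p)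
  sym-anyˡ (here e)  = here (≈-sym e)
  sym-anyˡ (there m) = there (sym-anyˡ m)
  sym-allˡ []       = []
  sym-allˡ (p ∷ ps) = sym-anyˡ p ∷ sym-allˡ ps
  sym-anyʳ (here e)  = here (≈-sym e)
  sym-anyʳ (there m) = there (sym-anyʳ m)
  sym-allʳ []       = []
  sym-allʳ (p ∷ ps) = sym-anyʳ p ∷ sym-allʳ ps

  ≈-trans : ∀ {x} y {z} → x ≈ y → y ≈ z → x ≈ z
  ∈-subst : ∀ {x} Y {Z} → x ∈ Y → All (_∈ Z) Y → x ∈ Z
  ∋-subst : ∀ {z} Y {X} → Any (_≈ z) Y → All (λ y → Any (_≈ y) X) Y → Any (_≈ z) X
  ≈-trans (w β Y) (w≈ p q) (w≈ r s) =
    w≈ (All.map (λ m → ∈-subst Y m r) p) (All.map (λ m → ∋-subst Y m q) s)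
  ∈-subst (y ∷ Y) (here e)  (p ∷ _)  = Any.map (λ f → ≈-trans y e f) p
  ∈-subst (y ∷ Y) (there m) (_ ∷ ps) = ∈-subst Y m ps
  ∋-subst (y ∷ Y) (here e)  (p ∷ _)  = Any.map (λ f → ≈-trans y f e) p
  ∋-subst (y ∷ Y) (there m) (_ ∷ ps) = ∋-subst Y m ps

  val-cong : ∀ {x y} → x ≈ y → val x ≡ val y
  val-cong (w≈ _ _) = refl

  below-mono : ∀ {x y} → x ≈ y → (_∈ below x) ⊆ (_∈ below y)
  below-mono (w≈ {Y = Y} p _) m = ∈-subst Y m p

  ∈-resp : ∀ {x y Y} → x ≈ y → y ∈ Y → x ∈ Y
  ∈-resp {y = y} e = Any.map (≈-trans y e)

  ∉-below : ∀ x {z} → z ≈ x → ¬ (x ∈ below z)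
  ∉-list  : ∀ Y {z} → All (λ y → ¬ (z ≈ y × z ∈ below y)) Y
  ∉-below x@(w β Y) {z} e m = absurd Y (∉-list Y {x}) x∈Y
    where
    x∈Y : x ∈ Y
    x∈Y = below-mono e m
    absurd : ∀ Z → All (λ y → ¬ (x ≈ y × x ∈ below y)) Z → ¬ (x ∈ Z)
    absurd (_ ∷ _) (¬p ∷ _)  (here f)  = ¬p (f , below-mono f x∈Y)
    absurd (_ ∷ Z) (_ ∷ ¬ps) (there k) = absurd Z ¬ps k
  ∉-list []      = []
  ∉-list (y ∷ Y) = (λ (e , m) → ∉-below y (≈-refl y) (∈-resp (≈-sym e) m)) ∷ ∉-list Y

  Admissible-resp : ∀ {K β Y Y′} → Y ≐ Y′ → Admissible K β Y → Admissible K β Y′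
  Admissible-resp (to , from) a = record
    { Y⊆K        = λ m → Y⊆K (from m)
    ; decreasing = λ k l m → to (decreasing k l (from m))
    ; β⊆val      = λ m → β⊆val (from m)
    ; β≢val      = λ k (p , q) → β≢val k ((λ m → p (to m)) , (λ m → from (q m)))
    }
    where open Admissible a

  Admissible-≈ : ∀ {K x y} → x ≈ y →
                 Admissible K (val x) (_∈ below x) → Admissible K (val y) (_∈ below y)
  Admissible-≈ {K} {x} {y} e a =
    subst (λ β → Admissible K β (_∈ below y)) (val-cong e)
      (Admissible-resp {K} ((λ m → below-mono e m) , (λ m → below-mono (≈-sym e) m)) a)

  Stage-resp : ∀ d {x y} → x ≈ y → Stage d x → Stage d y
  Stage-resp zero          e ()
  Stage-resp (suc zero)    e a = Admissible-≈ {K = ∅} e a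
  Stage-resp (suc (suc d)) e (inj₁ s) = inj₁ (Stage-resp (suc d) e s)
  Stage-resp (suc (suc d)) e (inj₂ (a , ¬s)) =
    inj₂ (Admissible-≈ {K = Stage (suc d)} e a , λ s → ¬s λ m → s (below-mono e m))

  Stage-step : ∀ d {x} → Stage d x → Stage (suc d) x
  Stage-step (suc d) s = inj₁ s

  admissible : ∀ d {x} → Stage d x →
               ∃ λ e → Admissible (Stage e) (val x) (_∈ below x) × (Stage e ⊆ Stage d)
  admissible (suc zero)    a = zero , a , λ ()
  admissible (suc (suc d)) (inj₁ s) =
    let e , a , i = admissible (suc d) s in e , a , λ t → inj₁ (i t)
  admissible (suc (suc d)) (inj₂ (a , _)) = suc d , a , inj₁

  Stage-down : ∀ d {x y} → x ≤ y → Stage d y → Stage d x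
  Stage-down d (inj₂ e) s = Stage-resp d (≈-sym e) s
  Stage-down d (inj₁ m) s = let _ , a , i = admissible d s in i (Admissible.Y⊆K a m)

  below-down : ∀ {x y z} → InK z → x ≤ y → y ∈ below z → x ∈ below z
  below-down (d , s) l m =
    let e , a , _ = admissible d s
    in Admissible.decreasing a (Stage-down e l (Admissible.Y⊆K a m)) l m

  ≤-trans : ∀ {x y z} → InK z → x ≤ y → y ≤ z → x ≤ z
  ≤-trans k l        (inj₁ m) = inj₁ (below-down k l m)
  ≤-trans k (inj₁ m) (inj₂ e) = inj₁ (below-mono e m)
  ≤-trans {y = y} k (inj₂ f) (inj₂ e) = inj₂ (≈-trans y f e)

  ≤-antisym : ∀ {x y} → InK y → x ≤ y → y ≤ x → x ≈ y
  ≤-antisym k (inj₂ e) _        = e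
  ≤-antisym k (inj₁ m) (inj₂ e) = ≈-sym e
  ≤-antisym {y = y} k (inj₁ m) l@(inj₁ _) = ⊥-elim (∉-below y (≈-refl y) (below-down k l m))

  val-antitone : ∀ {x y} → InK y → x ≤ y → val y Sub.⊆ val x
  val-antitone (d , s) (inj₁ m) = let _ , a , _ = admissible d s in Admissible.β⊆val a m
  val-antitone k       (inj₂ e) = subst (λ β → β Sub.⊆ _) (val-cong e) id

K : ℕ → Poset 0ℓ 0ℓ 0ℓ
K n = record
  { Carrier = Σ (Code n) InK
  ; _≈_     = λ x y → proj₁ x ≈ proj₁ y
  ; _≤_     = λ x y → proj₁ x ≤ proj₁ y
  ; isPartialOrder = record
    { isPreorder = record
      { isEquivalence = record
        { refl  = ≈-refl _
        ; sym   = ≈-sym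
        ; trans = ≈-trans _
        }
      ; reflexive = inj₂
      ; trans     = λ {_} {_} {z} → ≤-trans (proj₂ z)
      }
    ; antisym = λ {_} {y} → ≤-antisym (proj₂ y)
    }
  }

------------------------------------------------------------------------
-- The Heyting algebra of decreasing subsets of a poset

module _ (P : Poset 0ℓ 0ℓ 0ℓ) where

  private module P = Poset P

  record DownSet : Set₁ where
    field
      mem  : Pred P.Carrier 0ℓ
      down : ∀ {x y} → x P.≤ y → mem y → mem x

  open DownSet

  -- In the implication, "v ∈ a implies v ∈ b" says that v lies in the union
  -- of the complement of a with b; asking it for all v ≤ x yields the largest
  -- decreasing set contained in that union.
  𝒪↓ : HeytingAlgebra (lsuc 0ℓ) 0ℓ 0ℓ
  𝒪↓ = record
    { Carrier = DownSet
    ; _≈_     = λ a b → mem a ≐ mem b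
    ; _≤_     = λ a b → mem a ⊆ mem b
    ; _∨_     = λ a b → record
      { mem  = λ x → mem a x ⊎ mem b x
      ; down = λ l → [ (λ p → inj₁ (down a l p)) , (λ q → inj₂ (down b l q)) ]′ }
    ; _∧_     = λ a b → record
      { mem  = λ x → mem a x × mem b x
      ; down = λ l (p , q) → down a l p , down b l q }
    ; _⇨_     = λ a b → record
      { mem  = λ x → ∀ {v} → v P.≤ x → mem a v → mem b v
      ; down = λ l f m → f (P.trans m l) }
    ; ⊤       = record { mem = U ; down = λ _ u → u }
    ; ⊥       = record { mem = ∅ ; down = λ _ () }
    ; isHeytingAlgebra = record
      { isBoundedLattice = record
        { isLattice = record
          { isPartialOrder = record
            { isPreorder = record
              { isEquivalence = record
                { refl  = id , id
                ; sym   = λ (p , q) → q , p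
                ; trans = λ (p , q) (r , s) → (λ m → r (p m)) , (λ m → q (s m))
                }
              ; reflexive = proj₁
              ; trans     = λ p q m → q (p m)
              }
            ; antisym = λ p q → p , q
            }
          ; supremum = λ _ _ → inj₁ , inj₂ , λ _ p q → [ p , q ]′
          ; infimum  = λ _ _ → proj₁ , proj₂ , λ _ p q m → p m , q m
          }
        ; maximum = λ _ _ → _
        ; minimum = λ _ ()
        }
      ; exponential = λ c _ _ →
          (λ f m l p → f (down c l m , p)) ,
          (λ f (m , p) → f m P.refl p)
      }
    }

------------------------------------------------------------------------
-- Heyting subalgebras

module _ {c ℓ₁ ℓ₂ : Level} (H : HeytingAlgebra c ℓ₁ ℓ₂) where

  open HeytingAlgebra H using (Carrier; _∨_; _∧_; _⇨_; ⊤; ⊥)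
    renaming (_≈_ to _≈ᴴ_; _≤_ to _≤ᴴ_)
  private module H = HeytingAlgebra H

  record Subalgebra (p : Level) : Set (c ⊔ ℓ₁ ⊔ lsuc p) where
    field
      Member : Pred Carrier p
      resp   : ∀ {a b} → a ≈ᴴ b → Member a → Member b
      ⊤-mem  : Member ⊤
      ⊥-mem  : Member ⊥
      ∧-mem  : ∀ {a b} → Member a → Member b → Member (a ∧ b)
      ∨-mem  : ∀ {a b} → Member a → Member b → Member (a ∨ b)
      ⇨-mem  : ∀ {a b} → Member a → Member b → Member (a ⇨ b)

  algebra : ∀ {p} → Subalgebra p → HeytingAlgebra (c ⊔ p) ℓ₁ ℓ₂
  algebra S = record
    { Carrier = Σ Carrier Member
    ; _≈_     = λ a b → proj₁ a ≈ᴴ proj₁ b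
    ; _≤_     = λ a b → proj₁ a ≤ᴴ proj₁ b
    ; _∨_     = λ (a , p) (b , q) → a ∨ b , ∨-mem p q
    ; _∧_     = λ (a , p) (b , q) → a ∧ b , ∧-mem p q
    ; _⇨_     = λ (a , p) (b , q) → a ⇨ b , ⇨-mem p q
    ; ⊤       = ⊤ , ⊤-mem
    ; ⊥       = ⊥ , ⊥-mem
    ; isHeytingAlgebra = record
      { isBoundedLattice = record
        { isLattice = record
          { isPartialOrder = record
            { isPreorder = record
              { isEquivalence = record
                { refl  = H.Eq.refl
                ; sym   = H.Eq.sym
                ; trans = H.Eq.trans
                }
              ; reflexive = H.reflexive
              ; trans     = H.trans
              }
            ; antisym = H.antisym
            }
          ; supremum = λ (a , _) (b , _) →
              let l , r , s = H.supremum a b in l , r , λ (z , _) → s z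
          ; infimum  = λ (a , _) (b , _) →
              let l , r , s = H.infimum a b in l , r , λ (z , _) → s z
          }
        ; maximum = λ (a , _) → H.maximum a
        ; minimum = λ (a , _) → H.minimum a
        }
      ; exponential = λ (a , _) (b , _) (z , _) → H.exponential a b z
      }
    }
    where open Subalgebra S

  data Generated {i} {I : Set i} (g : I → Carrier) : Carrier → Set (c ⊔ ℓ₁ ⊔ i) where
    gen  : ∀ i → Generated g (g i)
    resp : ∀ {a b} → a ≈ᴴ b → Generated g a → Generated g b
    top  : Generated g ⊤
    bot  : Generated g ⊥
    meet : ∀ {a b} → Generated g a → Generated g b → Generated g (a ∧ b)
    join : ∀ {a b} → Generated g a → Generated g b → Generated g (a ∨ b)
    impl : ∀ {a b} → Generated g a → Generated g b → Generated g (a ⇨ b)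

  generatedBy : ∀ {i} {I : Set i} → (I → Carrier) → Subalgebra (c ⊔ ℓ₁ ⊔ i)
  generatedBy g = record
    { Member = Generated g
    ; resp   = resp
    ; ⊤-mem  = top
    ; ⊥-mem  = bot
    ; ∧-mem  = meet
    ; ∨-mem  = join
    ; ⇨-mem  = impl
    }

------------------------------------------------------------------------
-- 𝓕̂ n and, inside it, the free Heyting algebra 𝓕 n, which is identified
-- (by a theorem of Bellissima) with the subalgebra generated by the g_i

𝓕̂ : ℕ → HeytingAlgebra (lsuc 0ℓ) 0ℓ 0ℓ
𝓕̂ n = 𝒪↓ (K n)

generator : ∀ n → Fin n → HeytingAlgebra.Carrier (𝓕̂ n)
generator n i = record
  { mem  = λ x → i Sub.∈ val (proj₁ x)
  ; down = λ {_} {y} l → val-antitone (proj₂ y) l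
  }

𝓕 : ∀ n → Subalgebra (𝓕̂ n) (lsuc 0ℓ)
𝓕 n = generatedBy (𝓕̂ n) (generator n)

------------------------------------------------------------------------
-- First-order logic in the language {0, 1, ⊓, ⊔, →}

infixr 7 _⊓̇_
infixr 6 _⊔̇_
infixr 5 _→̇_

data Term (k : ℕ) : Set where
  var              : Fin k → Term k
  0̇ 1̇              : Term k
  _⊓̇_ _⊔̇_ _→̇_      : Term k → Term k → Term k

infix  4 _≐̇_
infixr 3 _and_
infixr 2 _or_
infixr 1 _implies_

-- Formulas with free variables among k; a quantifier binds variable zero.
data Formula (k : ℕ) : Set where
  _≐̇_                    : Term k → Term k → Formula k
  falsum                 : Formula k
  _and_ _or_ _implies_   : Formula k → Formula k → Formula k
  forAll exists          : Formula (suc k) → Formula k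

module _ {c ℓ₁ ℓ₂ : Level} (H : HeytingAlgebra c ℓ₁ ℓ₂) where

  open HeytingAlgebra H using (Carrier; _∨_; _∧_; _⇨_; ⊤; ⊥)

  ⟦_⟧ : ∀ {k} → Term k → Vector Carrier k → Carrier
  ⟦ var i ⟧  ρ = ρ i
  ⟦ 0̇ ⟧      ρ = ⊥
  ⟦ 1̇ ⟧      ρ = ⊤
  ⟦ s ⊓̇ t ⟧  ρ = ⟦ s ⟧ ρ ∧ ⟦ t ⟧ ρ
  ⟦ s ⊔̇ t ⟧  ρ = ⟦ s ⟧ ρ ∨ ⟦ t ⟧ ρ
  ⟦ s →̇ t ⟧  ρ = ⟦ s ⟧ ρ ⇨ ⟦ t ⟧ ρ

infix 4 _⊨_[_]

-- The connectives are read in the ambient (constructive) logic; excluded middle is not assumed.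
_⊨_[_] : ∀ {c ℓ₁ ℓ₂} (H : HeytingAlgebra c ℓ₁ ℓ₂) {k} →
         Formula k → Vector (HeytingAlgebra.Carrier H) k → Set (c ⊔ ℓ₁)
_⊨_[_] {c} H (s ≐̇ t) ρ = Lift c (HeytingAlgebra._≈_ H (⟦_⟧ H s ρ) (⟦_⟧ H t ρ))
H ⊨ falsum        [ ρ ] = Poly.⊥
H ⊨ (φ and ψ)     [ ρ ] = H ⊨ φ [ ρ ] × H ⊨ ψ [ ρ ]
H ⊨ (φ or ψ)      [ ρ ] = H ⊨ φ [ ρ ] ⊎ H ⊨ ψ [ ρ ]
H ⊨ (φ implies ψ) [ ρ ] = H ⊨ φ [ ρ ] → H ⊨ ψ [ ρ ]
H ⊨ (forAll φ)    [ ρ ] = ∀ a → H ⊨ φ [ a Env.∷ ρ ]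
H ⊨ (exists φ)    [ ρ ] = ∃ λ a → H ⊨ φ [ a Env.∷ ρ ]

Sentence : Set
Sentence = Formula 0

ElementarilyEquivalent : ∀ {c ℓ₁ ℓ₂ c′ ℓ₁′ ℓ₂′} →
  HeytingAlgebra c ℓ₁ ℓ₂ → HeytingAlgebra c′ ℓ₁′ ℓ₂′ → Set (c ⊔ ℓ₁ ⊔ c′ ⊔ ℓ₁′)
ElementarilyEquivalent A B = ∀ (σ : Sentence) → A ⊨ σ [ Env.[] ] ⇔ B ⊨ σ [ Env.[] ]

ElementarySubstructure : ∀ {c ℓ₁ ℓ₂ p} (H : HeytingAlgebra c ℓ₁ ℓ₂) →
  Subalgebra H p → Set (c ⊔ ℓ₁ ⊔ p)
ElementarySubstructure H S =
  ∀ {k} (φ : Formula k) (ρ : Vector (HeytingAlgebra.Carrier (algebra H S)) k) →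
  algebra H S ⊨ φ [ ρ ] ⇔ H ⊨ φ [ proj₁ ∘ ρ ]

{-# OPTIONS --safe #-}

-- The elements g_1,…,g_n are definable in both algebras up to a permutation.  For points
-- a and b of K_n, the number of p with below(p) ⊆ ↓a ∪ ↓b ⊆ ↓p is 2^|val a ∩ val b|, so
-- "val a and val b are disjoint" is first order.  Points e_1,…,e_n with pairwise disjoint
-- non-empty values have singleton values {P_π(i)} for a permutation π, and g_π(i) consists
-- of the points whose value is not disjoint from that of e_i.  All this can be expressed in
-- any subalgebra containing g_1,…,g_n, as it contains ↓a for every point a.
-- Permutations of the P_i act on K_n, hence on both algebras.  So φ holds at t(g), where t
-- is a tuple of terms, if and only if φ holds at t(h) for some h satisfying the definition,
-- and this is a sentence.

module Submission where

import Data.Bool.Properties as Bool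
open import Data.Empty using (⊥-elim)
open import Data.Fin.Base using (Fin; zero; suc; _↑ˡ_; _↑ʳ_; punchOut)
import Data.Fin.Properties as Finₚ
import Data.Fin.Subset as Sub
open import Data.Fin.Subset using (Subset; ⁅_⁆; ∁; inside; outside)
import Data.Fin.Subset.Properties as Subₚ
open import Data.List.Base using (List; []; _∷_; _++_; lookup; length)
open import Data.List.Membership.Propositional.Properties using (∈-lookup)
open import Data.List.Relation.Unary.All as All using (All; []; _∷_)
open import Data.List.Relation.Unary.Any as Any using (Any; here; there)
import Data.List.Relation.Unary.Any.Properties as Anyₚ
import Data.Nat.Base as ℕ
open import Data.Nat.Base using (ℕ; zero; suc; _≥_; _+_)
import Data.Nat.Properties as ℕₚ
open import Data.Product.Base using (∃; ∃₂; _×_; _,_; proj₁; proj₂)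
import Data.Sum.Base as Sum
open import Data.Sum.Base using (_⊎_; inj₁; inj₂; [_,_]′)
import Data.Vec.Base as Vec
import Data.Vec.Functional as Env
open Env using (Vector)
import Data.Vec.Functional.Properties as Envₚ
import Data.Vec.Properties as Vecₚ
open import Function.Base using (_∘_; id)
open import Function.Bundles using (_⇔_; mk⇔; Equivalence)
open import Level using (Level; 0ℓ; _⊔_; lift) renaming (suc to lsuc)
open import Relation.Binary.Bundles using (Poset)
open import Relation.Binary.Lattice.Bundles using (HeytingAlgebra)
import Relation.Binary.Lattice.Properties.HeytingAlgebra as HA
import Relation.Binary.Lattice.Properties.JoinSemilattice as JS
import Relation.Binary.Lattice.Properties.MeetSemilattice as MS
open import Relation.Binary.PropositionalEquality.Core
  using (_≡_; _≢_; refl; subst; subst₂; sym; trans; cong; cong₂)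
open import Relation.Nullary using (¬_; Dec; yes; no)
open import Relation.Nullary.Decidable using (decidable-stable; map′; _×-dec_; _⊎-dec_)
open import Relation.Unary using (Pred; _⊆_; _≐_; U)
open import Defs

-- First-order logic

record Isomorphism {a b ℓ₁ ℓ₂ ℓ₃ ℓ₄ : Level}
                   (A : HeytingAlgebra a ℓ₁ ℓ₂) (B : HeytingAlgebra b ℓ₃ ℓ₄) :
                   Set (a ⊔ b ⊔ ℓ₁ ⊔ ℓ₃) where
  private
    module A = HeytingAlgebra A
    module B = HeytingAlgebra B
  field
    to         : A.Carrier → B.Carrier
    to-cong    : ∀ {x y} → x A.≈ y → to x B.≈ to y
    injective  : ∀ {x y} → to x B.≈ to y → x A.≈ y
    surjective : ∀ y → ∃ λ x → to x B.≈ y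
    ⊤-homo     : to A.⊤ B.≈ B.⊤
    ⊥-homo     : to A.⊥ B.≈ B.⊥
    ∧-homo     : ∀ x y → to (x A.∧ y) B.≈ to x B.∧ to y
    ∨-homo     : ∀ x y → to (x A.∨ y) B.≈ to x B.∨ to y
    ⇨-homo     : ∀ x y → to (x A.⇨ y) B.≈ to x B.⇨ to y

module _ {a b ℓ₁ ℓ₂ ℓ₃ ℓ₄ : Level}
         {A : HeytingAlgebra a ℓ₁ ℓ₂} {B : HeytingAlgebra b ℓ₃ ℓ₄}
         (I : Isomorphism A B) where

  open Isomorphism I
  private
    module A = HeytingAlgebra A
    module B = HeytingAlgebra B

  infix 4 _↝_

  _↝_ : ∀ {k} → Vector A.Carrier k → Vector B.Carrier k → Set ℓ₃
  ρ ↝ σ = ∀ i → to (ρ i) B.≈ σ i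

  ↝-∷ : ∀ {k x y} {ρ : Vector A.Carrier k} {σ} →
        to x B.≈ y → ρ ↝ σ → (x Env.∷ ρ) ↝ (y Env.∷ σ)
  ↝-∷ e r zero    = e
  ↝-∷ e r (suc i) = r i

  ⟦⟧-homo : ∀ {k} (t : Term k) {ρ σ} → ρ ↝ σ → to (⟦_⟧ A t ρ) B.≈ ⟦_⟧ B t σ
  ⟦⟧-homo (var i)  r = r i
  ⟦⟧-homo 0̇        r = ⊥-homo
  ⟦⟧-homo 1̇        r = ⊤-homo
  ⟦⟧-homo (s ⊓̇ t)  r =
    B.Eq.trans (∧-homo _ _) (MS.∧-cong B.meetSemilattice (⟦⟧-homo s r) (⟦⟧-homo t r))
  ⟦⟧-homo (s ⊔̇ t)  r =
    B.Eq.trans (∨-homo _ _) (JS.∨-cong B.joinSemilattice (⟦⟧-homo s r) (⟦⟧-homo t r))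
  ⟦⟧-homo (s →̇ t)  r =
    B.Eq.trans (⇨-homo _ _) (HA.⇨-cong B (⟦⟧-homo s r) (⟦⟧-homo t r))

  -- Preservation and reflection need each other: the premise of an implication is contravariant.
  -- Surjectivity up to `≈` serves `forAll` here and `exists` in the reflection.
  ⊨-preserved : ∀ {k} (φ : Formula k) {ρ σ} → ρ ↝ σ → A ⊨ φ [ ρ ] → B ⊨ φ [ σ ]
  ⊨-reflected : ∀ {k} (φ : Formula k) {ρ σ} → ρ ↝ σ → B ⊨ φ [ σ ] → A ⊨ φ [ ρ ]

  ⊨-preserved (s ≐̇ t) r (lift e) =
    lift (B.Eq.trans (B.Eq.sym (⟦⟧-homo s r)) (B.Eq.trans (to-cong e) (⟦⟧-homo t r)))
  ⊨-preserved falsum        r (lift ())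
  ⊨-preserved (φ and ψ)     r (p , q) = ⊨-preserved φ r p , ⊨-preserved ψ r q
  ⊨-preserved (φ or ψ)      r (inj₁ p) = inj₁ (⊨-preserved φ r p)
  ⊨-preserved (φ or ψ)      r (inj₂ q) = inj₂ (⊨-preserved ψ r q)
  ⊨-preserved (φ implies ψ) r f p = ⊨-preserved ψ r (f (⊨-reflected φ r p))
  ⊨-preserved (forAll φ)    r f y =
    let x , e = surjective y in ⊨-preserved φ (↝-∷ e r) (f x)
  ⊨-preserved (exists φ)    r (x , p) = to x , ⊨-preserved φ (↝-∷ B.Eq.refl r) p

  ⊨-reflected (s ≐̇ t) r (lift e) =
    lift (injective (B.Eq.trans (⟦⟧-homo s r) (B.Eq.trans e (B.Eq.sym (⟦⟧-homo t r)))))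
  ⊨-reflected falsum        r (lift ())
  ⊨-reflected (φ and ψ)     r (p , q) = ⊨-reflected φ r p , ⊨-reflected ψ r q
  ⊨-reflected (φ or ψ)      r (inj₁ p) = inj₁ (⊨-reflected φ r p)
  ⊨-reflected (φ or ψ)      r (inj₂ q) = inj₂ (⊨-reflected ψ r q)
  ⊨-reflected (φ implies ψ) r f p = ⊨-reflected ψ r (f (⊨-preserved φ r p))
  ⊨-reflected (forAll φ)    r f x = ⊨-reflected φ (↝-∷ B.Eq.refl r) (f (to x))
  ⊨-reflected (exists φ)    r (y , p) =
    let x , e = surjective y in x , ⊨-reflected φ (↝-∷ e r) p

-- Substitution of terms and existential closure

weaken : ∀ {k} → Term k → Term (suc k)
weaken (var i) = var (suc i)
weaken 0̇       = 0̇
weaken 1̇       = 1̇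
weaken (s ⊓̇ t) = weaken s ⊓̇ weaken t
weaken (s ⊔̇ t) = weaken s ⊔̇ weaken t
weaken (s →̇ t) = weaken s →̇ weaken t

substTerm : ∀ {k m} → (Fin k → Term m) → Term k → Term m
substTerm τ (var i) = τ i
substTerm τ 0̇       = 0̇
substTerm τ 1̇       = 1̇
substTerm τ (s ⊓̇ t) = substTerm τ s ⊓̇ substTerm τ t
substTerm τ (s ⊔̇ t) = substTerm τ s ⊔̇ substTerm τ t
substTerm τ (s →̇ t) = substTerm τ s →̇ substTerm τ t

lifted : ∀ {k m} → (Fin k → Term m) → Fin (suc k) → Term (suc m)
lifted τ zero    = var zero
lifted τ (suc i) = weaken (τ i)

substFormula : ∀ {k m} → (Fin k → Term m) → Formula k → Formula m
substFormula τ (s ≐̇ t)       = substTerm τ s ≐̇ substTerm τ t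
substFormula τ falsum        = falsum
substFormula τ (φ and ψ)     = substFormula τ φ and substFormula τ ψ
substFormula τ (φ or ψ)      = substFormula τ φ or substFormula τ ψ
substFormula τ (φ implies ψ) = substFormula τ φ implies substFormula τ ψ
substFormula τ (forAll φ)    = forAll (substFormula (lifted τ) φ)
substFormula τ (exists φ)    = exists (substFormula (lifted τ) φ)

existsAll : ∀ {m} → Formula m → Sentence
existsAll {zero}  φ = φ
existsAll {suc m} φ = existsAll (exists φ)

module _ {c ℓ₁ ℓ₂ : Level} (A : HeytingAlgebra c ℓ₁ ℓ₂) where

  private module A = HeytingAlgebra A

  -- Transport along `identity` replaces an environment by one with equivalent entries. Environments
  -- are functions, so even splitting one into head and tail relies on it.
  identity : Isomorphism A A
  identity = record
    { to         = id
    ; to-cong    = id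
    ; injective  = id
    ; surjective = λ y → y , A.Eq.refl
    ; ⊤-homo     = A.Eq.refl
    ; ⊥-homo     = A.Eq.refl
    ; ∧-homo     = λ _ _ → A.Eq.refl
    ; ∨-homo     = λ _ _ → A.Eq.refl
    ; ⇨-homo     = λ _ _ → A.Eq.refl
    }

  ⟦weaken⟧ : ∀ {k} (t : Term k) {x} {ρ : Vector A.Carrier k} →
             ⟦_⟧ A (weaken t) (x Env.∷ ρ) ≡ ⟦_⟧ A t ρ
  ⟦weaken⟧ (var i) = refl
  ⟦weaken⟧ 0̇       = refl
  ⟦weaken⟧ 1̇       = refl
  ⟦weaken⟧ (s ⊓̇ t) = cong₂ A._∧_ (⟦weaken⟧ s) (⟦weaken⟧ t)
  ⟦weaken⟧ (s ⊔̇ t) = cong₂ A._∨_ (⟦weaken⟧ s) (⟦weaken⟧ t)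
  ⟦weaken⟧ (s →̇ t) = cong₂ A._⇨_ (⟦weaken⟧ s) (⟦weaken⟧ t)

  private
    infix 4 _≋_
    _≋_ : ∀ {k} → Vector A.Carrier k → Vector A.Carrier k → Set ℓ₁
    _≋_ = _↝_ identity

  ⟦lifted⟧ : ∀ {k m} (τ : Fin k → Term m) {x} {ρ : Vector A.Carrier m} {σ} →
             (λ i → ⟦_⟧ A (τ i) ρ) ≋ σ →
             (λ i → ⟦_⟧ A (lifted τ i) (x Env.∷ ρ)) ≋ (x Env.∷ σ)
  ⟦lifted⟧ τ r zero    = A.Eq.refl
  ⟦lifted⟧ τ r (suc i) = A.Eq.trans (A.Eq.reflexive (⟦weaken⟧ (τ i))) (r i)

  ⟦substTerm⟧ : ∀ {k m} (τ : Fin k → Term m) (t : Term k) {ρ : Vector A.Carrier m} →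
                ⟦_⟧ A (substTerm τ t) ρ ≡ ⟦_⟧ A t (λ i → ⟦_⟧ A (τ i) ρ)
  ⟦substTerm⟧ τ (var i) = refl
  ⟦substTerm⟧ τ 0̇       = refl
  ⟦substTerm⟧ τ 1̇       = refl
  ⟦substTerm⟧ τ (s ⊓̇ t) = cong₂ A._∧_ (⟦substTerm⟧ τ s) (⟦substTerm⟧ τ t)
  ⟦substTerm⟧ τ (s ⊔̇ t) = cong₂ A._∨_ (⟦substTerm⟧ τ s) (⟦substTerm⟧ τ t)
  ⟦substTerm⟧ τ (s →̇ t) = cong₂ A._⇨_ (⟦substTerm⟧ τ s) (⟦substTerm⟧ τ t)

  ⟦substTerm⟧≈ : ∀ {k m} (τ : Fin k → Term m) (t : Term k) {ρ : Vector A.Carrier m} {σ} →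
                 (λ i → ⟦_⟧ A (τ i) ρ) ≋ σ → ⟦_⟧ A (substTerm τ t) ρ A.≈ ⟦_⟧ A t σ
  ⟦substTerm⟧≈ τ t r =
    A.Eq.trans (A.Eq.reflexive (⟦substTerm⟧ τ t)) (⟦⟧-homo identity t r)

  -- The environment `σ` is only required to agree pointwise up to `≈`, because that is all that
  -- survives when `lifted` passes under a quantifier.
  ⊨-subst : ∀ {k m} (τ : Fin k → Term m) (φ : Formula k) {ρ : Vector A.Carrier m} {σ} →
            (λ i → ⟦_⟧ A (τ i) ρ) ≋ σ → A ⊨ substFormula τ φ [ ρ ] ⇔ A ⊨ φ [ σ ]
  ⊨-subst τ (s ≐̇ t) r = mk⇔
    (λ (lift e) → lift (A.Eq.trans (A.Eq.sym es) (A.Eq.trans e et)))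
    (λ (lift e) → lift (A.Eq.trans es (A.Eq.trans e (A.Eq.sym et))))
    where
    es = ⟦substTerm⟧≈ τ s r
    et = ⟦substTerm⟧≈ τ t r
  ⊨-subst τ falsum        r = mk⇔ id id
  ⊨-subst τ (φ and ψ)     r = mk⇔
    (λ (p , q) → P.to p , Q.to q) (λ (p , q) → P.from p , Q.from q)
    where
    module P = Equivalence (⊨-subst τ φ r)
    module Q = Equivalence (⊨-subst τ ψ r)
  ⊨-subst τ (φ or ψ)      r = mk⇔
    [ inj₁ ∘ P.to , inj₂ ∘ Q.to ]′ [ inj₁ ∘ P.from , inj₂ ∘ Q.from ]′
    where
    module P = Equivalence (⊨-subst τ φ r)
    module Q = Equivalence (⊨-subst τ ψ r)
  ⊨-subst τ (φ implies ψ) r = mk⇔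
    (λ f p → Q.to (f (P.from p))) (λ f p → Q.from (f (P.to p)))
    where
    module P = Equivalence (⊨-subst τ φ r)
    module Q = Equivalence (⊨-subst τ ψ r)
  ⊨-subst τ (forAll φ)    r = mk⇔
    (λ f x → Equivalence.to (⊨-subst (lifted τ) φ (⟦lifted⟧ τ r)) (f x))
    (λ f x → Equivalence.from (⊨-subst (lifted τ) φ (⟦lifted⟧ τ r)) (f x))
  ⊨-subst τ (exists φ)    r = mk⇔
    (λ (x , p) → x , Equivalence.to (⊨-subst (lifted τ) φ (⟦lifted⟧ τ r)) p)
    (λ (x , p) → x , Equivalence.from (⊨-subst (lifted τ) φ (⟦lifted⟧ τ r)) p)

  ⊨-existsAll : ∀ {m} (φ : Formula m) →
                A ⊨ existsAll φ [ Env.[] ] ⇔ ∃ λ ρ → A ⊨ φ [ ρ ]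
  ⊨-existsAll {zero}  φ = mk⇔
    (λ p → Env.[] , p) (λ (_ , p) → ⊨-preserved identity φ (λ ()) p)
  ⊨-existsAll {suc m} φ = mk⇔
    (λ p → let ρ , x , q = E.to p in x Env.∷ ρ , q)
    (λ (ρ , p) → E.from (Env.tail ρ , Env.head ρ , ⊨-preserved identity φ head∷tail p))
    where
    module E = Equivalence (⊨-existsAll (exists φ))
    head∷tail : ∀ {ρ} → ρ ≋ (Env.head ρ Env.∷ Env.tail ρ)
    head∷tail zero    = A.Eq.refl
    head∷tail (suc _) = A.Eq.refl

-- Points of K_n

module _ {n : ℕ} where

  infix 4 _≈?_ _≤?_

  -- Codes are finite, so their equality and order are decidable. Excluded middle is not assumed,
  -- and later arguments by contradiction rest on this through `decidable-stable`.
  _≈?_   : (x y : Code n) → Dec (x ≈ y)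
  _∈?_   : (x : Code n) (Y : List (Code n)) → Dec (x ∈ Y)
  _∋?_   : (X : List (Code n)) (y : Code n) → Dec (Any (_≈ y) X)
  all∈?  : (X Y : List (Code n)) → Dec (All (_∈ Y) X)
  all∋?  : (X Y : List (Code n)) → Dec (All (λ y → Any (_≈ y) X) Y)
  w β X ≈? w γ Y with Vecₚ.≡-dec Bool._≟_ β γ
  ... | no β≢γ = no λ e → β≢γ (val-cong e)
  ... | yes refl = map′ (λ (p , q) → w≈ p q) (λ { (w≈ p q) → p , q })
                        (all∈? X Y ×-dec all∋? X Y)
  x ∈? []      = no λ ()
  x ∈? (y ∷ Y) = map′ Any.fromSum Any.toSum (x ≈? y ⊎-dec x ∈? Y)
  []      ∋? y = no λ ()
  (x ∷ X) ∋? y = map′ Any.fromSum Any.toSum (x ≈? y ⊎-dec X ∋? y)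
  all∈? []      Y = yes []
  all∈? (x ∷ X) Y = map′ (λ (p , q) → p ∷ q) (λ { (p ∷ q) → p , q }) (x ∈? Y ×-dec all∈? X Y)
  all∋? X []      = yes []
  all∋? X (y ∷ Y) = map′ (λ (p , q) → p ∷ q) (λ { (p ∷ q) → p , q }) (X ∋? y ×-dec all∋? X Y)

  _≤?_ : (x y : Code n) → Dec (x ≤ y)
  x ≤? y = (x ∈? below y) ⊎-dec (x ≈? y)

  ≤-refl : ∀ (x : Code n) → x ≤ x
  ≤-refl x = inj₂ (≈-refl x)

  ≈-ext : ∀ {x y : Code n} → val x ≡ val y →
          (_∈ below x) ⊆ (_∈ below y) → (_∈ below y) ⊆ (_∈ below x) → x ≈ y
  ≈-ext {w _ X} {w _ Y} refl p q = w≈ (half X (λ {x} → p {x})) (sym-allˡ (half Y (λ {x} → q {x})))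
    where
    half : ∀ X {Y} → (_∈ X) ⊆ (_∈ Y) → All (_∈ Y) X
    half []      p = []
    half (x ∷ X) p = p (here (≈-refl x)) ∷ half X (p ∘ there)

  ≤-respʳ : ∀ {x y z : Code n} → x ≤ y → y ≈ z → x ≤ z
  ≤-respʳ (inj₁ m) e = inj₁ (below-mono e m)
  ≤-respʳ {y = y} (inj₂ f) e = inj₂ (≈-trans y f e)

  ≤-respˡ : ∀ {x y z : Code n} → x ≈ y → y ≤ z → x ≤ z
  ≤-respˡ e (inj₁ m) = inj₁ (∈-resp e m)
  ≤-respˡ {y = y} e (inj₂ f) = inj₂ (≈-trans y e f)

  InK-≤ : ∀ {x y : Code n} → x ≤ y → InK y → InK x
  InK-≤ l (d , s) = d , Stage-down d l s

  -- The two ways of lying in a stage exclude each other: a member of `Stage (suc d)` has all its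
  -- strict predecessors in `Stage d`, which a newly added code violates.
  Stage? : ∀ d {x : Code n} → Stage (suc d) x → Dec (Stage d x)
  Stage? zero    s = no λ ()
  Stage? (suc d) (inj₁ s) = yes s
  Stage? (suc d) (inj₂ (_ , ¬s)) = no λ t → ¬s λ m → below⊆ d t m
    where
    below⊆ : ∀ d {x} → Stage (suc d) x → (_∈ below x) ⊆ Stage d
    below⊆ zero    a = Admissible.Y⊆K a
    below⊆ (suc d) (inj₁ s) m = Stage-step d (below⊆ d s m)
    below⊆ (suc d) (inj₂ (a , _)) = Admissible.Y⊆K a

  Stage-all? : ∀ d {Y : List (Code n)} → All (Stage (suc d)) Y → Dec (All (Stage d) Y)
  Stage-all? d []       = yes []
  Stage-all? d (s ∷ ss) =
    map′ (λ (p , q) → p ∷ q) (λ { (p ∷ q) → p , q }) (Stage? d s ×-dec Stage-all? d ss)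

  lookup∈ : ∀ {P : Pred (Code n) 0ℓ} {Y : List (Code n)} → (∀ {x y} → x ≈ y → P y → P x) →
            All P Y → (_∈ Y) ⊆ P
  lookup∈ r (p ∷ _)  (here e)  = r e p
  lookup∈ r (_ ∷ ps) (there m) = lookup∈ r ps m

  tabulate∈ : ∀ {P : Pred (Code n) 0ℓ} Y → (∀ {y} → y ∈ Y → P y) → All P Y
  tabulate∈ []      p = []
  tabulate∈ (y ∷ Y) p = p (here (≈-refl y)) ∷ tabulate∈ Y (λ m → p (there m))

  Stage-mono : ∀ {d e} → d ℕ.≤′ e → {x : Code n} → Stage d x → Stage e x
  Stage-mono ℕ.≤′-refl             s = s
  Stage-mono (ℕ.≤′-step {zero}  l) s = ⊥-elim (Stage-mono l s)
  Stage-mono (ℕ.≤′-step {suc e} l) s = inj₁ (Stage-mono l s)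

  stage-bound : ∀ {Y : List (Code n)} → All InK Y → ∃ λ d → All (Stage d) Y
  stage-bound [] = zero , []
  stage-bound ((d , s) ∷ ks) =
    let e , ss = stage-bound ks in
    d ℕ.⊔ e , Stage-mono (ℕₚ.≤⇒≤′ (ℕₚ.m≤m⊔n d e)) s
          ∷ All.map (λ {y} → Stage-mono (ℕₚ.≤⇒≤′ (ℕₚ.m≤n⊔m d e)) {y}) ss

  -- Admissibility relative to all of K_n instead of a stage.
  record Admissible′ (β : Subset n) (Y : List (Code n)) : Set where
    field
      Y⊆K        : All InK Y
      decreasing : ∀ {x y} → x ≤ y → y ∈ Y → x ∈ Y
      β⊆val      : ∀ {y} → y ∈ Y → β Sub.⊆ val y
      β≢val      : ∀ {y} → y ∈ Y → (∀ {x} → x ∈ Y → x ≤ y) → β ≢ val y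

  -- Finiteness of `Y` gives a stage containing it. Descending for as long as the preceding stage
  -- still contains `Y` reaches the stage on top of which `w β Y` is added.
  InK-intro : ∀ {β Y} → Admissible′ β Y → InK (w β Y)
  InK-intro {β} {Y} a = let d , ss = stage-bound Y⊆K in go d ss
    where
    open Admissible′ a
    go : ∀ d → All (Stage d) Y → InK (w β Y)
    adm : ∀ d → All (Stage d) Y → Admissible (Stage d) β (_∈ Y)
    adm d ss = record
      { Y⊆K        = lookup∈ (λ e → Stage-resp d (≈-sym e)) ss
      ; decreasing = λ _ → decreasing
      ; β⊆val      = β⊆val
      ; β≢val      = λ {y} s (p , q) → β≢val (q (s , ≤-refl y)) (λ m → proj₂ (p m))
      }
    -- `Stage zero` is empty, hence so is `Y`; the code enters at `Stage 1`, where no preceding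
    -- stage has to be exceeded.
    go zero    ss = 1 , adm zero ss
    go (suc d) ss with Stage-all? d ss
    ... | yes ts = go d ts
    ... | no ¬ts = suc (suc d) , inj₂ (adm (suc d) ss , λ s → ¬ts (tabulate∈ Y s))

  InK-elim : ∀ {x} → InK x → Admissible′ (val x) (below x)
  InK-elim {x} k@(d , s) with admissible d s
  ... | e , a , _ = record
    { Y⊆K        = tabulate∈ (below x) λ m → e , A.Y⊆K m
    ; decreasing = λ l m → below-down k l m
    ; β⊆val      = A.β⊆val
    ; β≢val      = λ m g → A.β≢val (A.Y⊆K m)
        ((λ m′ → A.Y⊆K m′ , g m′) , (λ (_ , l) → below-down k l m))
    }
    where module A = Admissible a

-- Relabelling the symbols P_i

module _ {n : ℕ} where

  pull : (Fin n → Fin n) → Subset n → Subset n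
  pull π β = Vec.tabulate (λ i → Vec.lookup β (π i))

  ∈-pull⁺ : ∀ π {β i} → π i Sub.∈ β → i Sub.∈ pull π β
  ∈-pull⁺ π {β} {i} m =
    Vecₚ.lookup⇒[]= i _ (trans (Vecₚ.lookup∘tabulate _ i) (Vecₚ.[]=⇒lookup m))

  ∈-pull⁻ : ∀ π {β i} → i Sub.∈ pull π β → π i Sub.∈ β
  ∈-pull⁻ π {β} {i} m =
    Vecₚ.lookup⇒[]= (π i) β (trans (sym (Vecₚ.lookup∘tabulate _ i)) (Vecₚ.[]=⇒lookup m))

  pull-inverse : ∀ π σ → (∀ i → π (σ i) ≡ i) → ∀ β → pull σ (pull π β) ≡ β
  pull-inverse π σ inv β = trans
    (Vecₚ.tabulate-cong λ i →
      trans (Vecₚ.lookup∘tabulate _ (σ i)) (cong (Vec.lookup β) (inv i)))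
    (Vecₚ.tabulate∘lookup β)

  relabel  : (Fin n → Fin n) → Code n → Code n
  relabels : (Fin n → Fin n) → List (Code n) → List (Code n)
  relabel π (w β Y) = w (pull π β) (relabels π Y)
  relabels π []      = []
  relabels π (y ∷ Y) = relabel π y ∷ relabels π Y

  relabel-inverse  : ∀ π σ → (∀ i → π (σ i) ≡ i) → ∀ x → relabel σ (relabel π x) ≡ x
  relabels-inverse : ∀ π σ → (∀ i → π (σ i) ≡ i) → ∀ X → relabels σ (relabels π X) ≡ X
  relabel-inverse π σ inv (w β Y) = cong₂ w (pull-inverse π σ inv β) (relabels-inverse π σ inv Y)
  relabels-inverse π σ inv []      = refl
  relabels-inverse π σ inv (y ∷ Y) =
    cong₂ _∷_ (relabel-inverse π σ inv y) (relabels-inverse π σ inv Y)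

  val-relabel : ∀ π (x : Code n) → val (relabel π x) ≡ pull π (val x)
  val-relabel π (w β Y) = refl

  module _ (π : Fin n → Fin n) where

    relabel-≈  : ∀ {x y} → x ≈ y → relabel π x ≈ relabel π y
    relabel-∈  : ∀ {x Y} → x ∈ Y → relabel π x ∈ relabels π Y
    relabel-∋  : ∀ {X y} → Any (_≈ y) X → Any (_≈ relabel π y) (relabels π X)
    relabel-⊆  : ∀ {X Y} → All (_∈ Y) X → All (_∈ relabels π Y) (relabels π X)
    relabel-⊇  : ∀ {X Y} → All (λ y → Any (_≈ y) X) Y →
                 All (λ y → Any (_≈ y) (relabels π X)) (relabels π Y)
    relabel-≈ (w≈ p q) = w≈ (relabel-⊆ p) (relabel-⊇ q)
    relabel-∈ (here e)  = here (relabel-≈ e)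
    relabel-∈ (there m) = there (relabel-∈ m)
    relabel-∋ (here e)  = here (relabel-≈ e)
    relabel-∋ (there m) = there (relabel-∋ m)
    relabel-⊆ []       = []
    relabel-⊆ (p ∷ ps) = relabel-∈ p ∷ relabel-⊆ ps
    relabel-⊇ []       = []
    relabel-⊇ (p ∷ ps) = relabel-∋ p ∷ relabel-⊇ ps

    relabel-≤ : ∀ {x y} → x ≤ y → relabel π x ≤ relabel π y
    relabel-≤ {y = w _ _} (inj₁ m) = inj₁ (relabel-∈ m)
    relabel-≤ (inj₂ e) = inj₂ (relabel-≈ e)

    ∈-relabels⁻ : ∀ {x} Y → x ∈ relabels π Y → ∃ λ y → y ∈ Y × x ≈ relabel π y
    ∈-relabels⁻ (y ∷ Y) (here e)  = y , here (≈-refl y) , e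
    ∈-relabels⁻ (y ∷ Y) (there m) =
      let z , m′ , e = ∈-relabels⁻ Y m in z , there m′ , e

  module _ (π σ : Fin n → Fin n) (πσ : ∀ i → π (σ i) ≡ i) (σπ : ∀ i → σ (π i) ≡ i) where

    -- Order relations and equalities between values are carried back along the inverse `σ` to the
    -- original code, whose admissibility is known.
    relabel-InK  : ∀ x → InK x → InK (relabel π x)
    relabels-InK : ∀ X → All InK X → All InK (relabels π X)
    relabels-InK []      []       = []
    relabels-InK (x ∷ X) (k ∷ ks) = relabel-InK x k ∷ relabels-InK X ks
    relabel-InK (w β Y) k = InK-intro record
      { Y⊆K        = relabels-InK Y Y⊆K
      ; decreasing = λ {x} l m →
          let y₀ , m₀ , e = ∈-relabels⁻ π Y m
              x∈Y = decreasing (≤-resp-≈ (relabel-≤ σ l) e) m₀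
          in subst (_∈ relabels π Y) (relabel-inverse σ π σπ x) (relabel-∈ π x∈Y)
      ; β⊆val      = λ {y} m i∈ →
          let y₀ , m₀ , e = ∈-relabels⁻ π Y m
          in subst (_ Sub.∈_) (sym (trans (val-cong e) (val-relabel π y₀)))
               (∈-pull⁺ π (β⊆val m₀ (∈-pull⁻ π i∈)))
      ; β≢val      = λ {y} m g eq →
          let y₀ , m₀ , e = ∈-relabels⁻ π Y m
          in β≢val m₀
               (λ {x} x∈Y → subst (_≤ y₀) (relabel-inverse π σ πσ x)
                 (≤-resp-≈ (relabel-≤ σ (g (relabel-∈ π x∈Y))) e))
               (trans (sym (pull-inverse π σ πσ β))
                 (trans (cong (pull σ) (trans eq (trans (val-cong e) (val-relabel π y₀))))
                   (pull-inverse π σ πσ (val y₀))))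
      }
      where
      open Admissible′ (InK-elim k)
      ≤-resp-≈ : ∀ {x y y₀} → x ≤ relabel σ y → y ≈ relabel π y₀ → x ≤ y₀
      ≤-resp-≈ {x} {y} {y₀} l e =
        ≤-respʳ l (subst (relabel σ y ≈_) (relabel-inverse π σ πσ y₀) (relabel-≈ σ e))

-- Definability of principal down-sets

Code-induction : ∀ {n} {p : Level} {P : Code n → Set p} →
                 (∀ x → All P (below x) → P x) → ∀ x → P x
Code-induction {n} {P = P} step = go
  where
  go  : ∀ x → P x
  all : ∀ X → All P X
  go x@(w _ X) = step x (all X)
  all []      = []
  all (x ∷ X) = go x ∷ all X

lookup-∈ : ∀ {n} (Y : List (Code n)) j → lookup Y j ∈ Y
lookup-∈ (y ∷ Y) zero    = here (≈-refl y)
lookup-∈ (y ∷ Y) (suc j) = there (lookup-∈ Y j)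

module _ {n : ℕ} where

  Point : Set
  Point = Poset.Carrier (K n)

  open DownSet

  ↓ : Point → DownSet (K n)
  ↓ p = record
    { mem  = λ x → proj₁ x ≤ proj₁ p
    ; down = λ l m → ≤-trans (proj₂ p) l m }

  ↧ : Point → DownSet (K n)
  ↧ p = record
    { mem  = λ x → proj₁ x ∈ below (proj₁ p)
    ; down = λ l m → below-down (proj₂ p) l m }

  ↑ᶜ : Point → DownSet (K n)
  ↑ᶜ p = record
    { mem  = λ x → ¬ proj₁ p ≤ proj₁ x
    ; down = λ {_} {y} l ¬m m → ¬m (≤-trans (proj₂ y) m l) }

  ⋃ ⋂ : ∀ {m} → Subset m → (Fin m → DownSet (K n)) → DownSet (K n)
  ⋃ β f = record
    { mem  = λ x → ∃ λ i → i Sub.∈ β × mem (f i) x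
    ; down = λ l (i , i∈ , m) → i , i∈ , down (f i) l m }
  ⋂ β f = record
    { mem  = λ x → ∀ i → i Sub.∈ β → mem (f i) x
    ; down = λ l h i i∈ → down (f i) l (h i i∈) }

  module _ {p : Level} (S : Subalgebra (𝓕̂ n) p) where

    open Subalgebra S renaming (resp to Member-resp)

    ⋃-mem : ∀ {m} (β : Subset m) {f} → (∀ i → Member (f i)) → Member (⋃ β f)
    ⋃-mem Vec.[] f∈ = Member-resp ((λ ()) , λ { (() , _) }) ⊥-mem
    ⋃-mem (inside Vec.∷ β) f∈ = Member-resp
      ( (λ { (inj₁ m) → zero , Vec.here , m ; (inj₂ (i , i∈ , m)) → suc i , Vec.there i∈ , m })
      , (λ { (zero , Vec.here , m) → inj₁ m ; (suc i , Vec.there i∈ , m) → inj₂ (i , i∈ , m) }))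
      (∨-mem (f∈ zero) (⋃-mem β (f∈ ∘ suc)))
    ⋃-mem (outside Vec.∷ β) f∈ = Member-resp
      ( (λ (i , i∈ , m) → suc i , Vec.there i∈ , m)
      , (λ { (suc i , Vec.there i∈ , m) → i , i∈ , m }))
      (⋃-mem β (f∈ ∘ suc))

    ⋂-mem : ∀ {m} (β : Subset m) {f} → (∀ i → Member (f i)) → Member (⋂ β f)
    ⋂-mem Vec.[] f∈ = Member-resp ((λ _ _ ()) , λ _ → _) ⊤-mem
    ⋂-mem (inside Vec.∷ β) f∈ = Member-resp
      ( (λ { (m , h) zero Vec.here → m ; (m , h) (suc i) (Vec.there i∈) → h i i∈ })
      , (λ h → h zero Vec.here , λ i i∈ → h (suc i) (Vec.there i∈)))
      (∧-mem (f∈ zero) (⋂-mem β (f∈ ∘ suc)))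
    ⋂-mem (outside Vec.∷ β) f∈ = Member-resp
      ( (λ { h (suc i) (Vec.there i∈) → h i i∈ })
      , (λ h i i∈ → h (suc i) (Vec.there i∈)))
      (⋂-mem β (f∈ ∘ suc))

    module _ (generator-mem : ∀ i → Member (generator n i)) where

      private
        module Step (c : Code n) (k : InK c) where
          Y = below c

          y : Fin (length Y) → Point
          y j = lookup Y j , InK-≤ {x = lookup Y j} {y = c} (inj₁ (lookup-∈ Y j)) k

          ⋃↓ ⋃↑ᶜ Φ : DownSet (K n)
          ⋃↓  = ⋃ Sub.⊤ (↓ ∘ y)
          ⋃↑ᶜ = ⋃ Sub.⊤ (↑ᶜ ∘ y)

          open HeytingAlgebra (𝓕̂ n) using (_∨_; _∧_; _⇨_)

          -- De Jongh's formula: a point outside Y satisfying it has the same value as c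
          -- and lies above every element of Y.
          Φ = ⋂ (val c) (generator n) ∧ ((⋃ (∁ (val c)) (generator n) ∨ ⋃↑ᶜ) ⇨ ⋃↓)

          ⋃↓≐↧ : mem ⋃↓ ≐ mem (↧ (c , k))
          ⋃↓≐↧ =
            (λ {x} (j , _ , l) → below-down {x = proj₁ x} {z = c} k l (lookup-∈ Y j)) ,
            (λ m → Any.index m , Subₚ.∈⊤ , inj₂ (Anyₚ.lookup-index m))

          -- Strictly below `c` the conclusion `⋃↓` holds outright. At `c` itself the premise fails:
          -- no symbol outside `val c` is present, and every element of `Y` lies below.
          ↓⊆Φ : mem (↓ (c , k)) ⊆ mem Φ
          ↓⊆Φ {x} x≤c =
            (λ i i∈ → val-antitone {x = proj₁ x} {y = c} k x≤c i∈) ,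
            (λ {v} v≤x h → proj₂ ⋃↓≐↧ {v} (inner v (≤-trans k v≤x x≤c) h))
            where
            inner : ∀ v → proj₁ v ≤ c →
                    mem (⋃ (∁ (val c)) (generator n)) v ⊎ mem ⋃↑ᶜ v → proj₁ v ∈ Y
            inner v (inj₁ m) h = m
            inner v (inj₂ e) (inj₁ (i , i∉ , m)) =
              ⊥-elim (Subₚ.x∈∁p⇒x∉p i∉ (subst (i Sub.∈_) (val-cong e) m))
            inner v (inj₂ e) (inj₂ (j , _ , ¬l)) =
              ⊥-elim (¬l (≤-respʳ {y = c} (inj₁ (lookup-∈ Y j)) (≈-sym e)))

          -- Induction on `x`, which may be assumed to lie outside `Y`, so that it has the value of
          -- `c` and lies above `Y`. By induction its strict predecessors lie below `c`. If `c` were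
          -- one of them it would be their maximum, with the same value as `x`, against
          -- admissibility; otherwise they are exactly `Y`, and `x ≈ c`.
          Φ⊆↓ : ∀ x (kx : InK x) → mem Φ (x , kx) → x ≤ c
          Φ⊆↓ = Code-induction step
            where
            step : ∀ x → All (λ v → ∀ kv → mem Φ (v , kv) → v ≤ c) (below x) →
                   ∀ kx → mem Φ (x , kx) → x ≤ c
            step x@(w γ X) ih kx h@(β⊆ , f) =
              decidable-stable (x ≤? c) λ x≰c → x≰c (inj₂ (x≈c (x≰c ∘ inj₁)))
              where
              module _ (x∉Y : ¬ x ∈ Y) where
                open Admissible′ (InK-elim kx)
                val⊆ : val x Sub.⊆ val c
                val⊆ {i} i∈ = decidable-stable (i Subₚ.∈? val c) λ i∉ →
                  x∉Y (proj₁ ⋃↓≐↧ {x , kx}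
                    (f {x , kx} (≤-refl x) (inj₁ (i , Subₚ.x∉p⇒x∈∁p i∉ , i∈))))
                val≡ : val x ≡ val c
                val≡ = Subₚ.⊆-antisym val⊆ (λ i∈ → β⊆ _ i∈)
                Y≤x : ∀ j → lookup Y j ≤ x
                Y≤x j = decidable-stable (lookup Y j ≤? x) λ ¬l →
                  x∉Y (proj₁ ⋃↓≐↧ {x , kx} (f {x , kx} (≤-refl x) (inj₂ (j , Subₚ.∈⊤ , ¬l))))
                Y⊆X : (_∈ Y) ⊆ (_∈ X)
                Y⊆X {v} m with Y≤x (Any.index m)
                ... | inj₁ m′ = ∈-resp (Anyₚ.lookup-index m) m′
                ... | inj₂ e = ⊥-elim (x∉Y (∈-resp (≈-sym e) (lookup-∈ Y (Any.index m))))
                X≤c : ∀ {v} → v ∈ X → v ≤ c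
                X≤c {v} m = let kv = InK-≤ {x = v} {y = x} (inj₁ m) kx in
                  -- Membership in `X` is up to `≈`, whereas the induction hypothesis speaks of the
                  -- listed codes, so it is transported along `≈`.
                  lookup∈ {P = λ v → ∀ kv → mem Φ (v , kv) → v ≤ c}
                  (λ {a} {b} e g ka hΦ →
                    ≤-trans k (inj₂ e) (g (InK-≤ (inj₂ (≈-sym e)) ka)
                      (down Φ {b , InK-≤ (inj₂ (≈-sym e)) ka} {a , ka} (inj₂ (≈-sym e)) hΦ)))
                  ih m kv (down Φ {v , kv} {x , kx} (inj₁ m) h)
                x≈c : x ≈ c
                x≈c with c ∈? X
                ... | yes c∈X = ⊥-elim (β≢val c∈X X≤c val≡)
                ... | no c∉X = ≈-ext val≡ X⊆Y Y⊆X
                  where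
                  X⊆Y : (_∈ X) ⊆ (_∈ Y)
                  X⊆Y m with X≤c m
                  ... | inj₁ m′ = m′
                  ... | inj₂ e = ⊥-elim (c∉X (∈-resp (≈-sym e) m))

          -- The only point of `↓ (c , k)` missing from `↧ (c , k)` is `c`, so the implication holds
          -- at a point exactly when `c` is not below it.
          ⇨≐↑ᶜ : mem (↓ (c , k) ⇨ ↧ (c , k)) ≐ mem (↑ᶜ (c , k))
          ⇨≐↑ᶜ =
            (λ f l → ∉-below c (≈-refl c) (f {c , k} l (≤-refl c))) ,
            (λ ¬l v≤x → λ
              { (inj₁ m) → m
              ; (inj₂ e) → ⊥-elim (¬l (≤-respˡ (≈-sym e) v≤x)) })

      -- One induction handles both kinds of set, since De Jongh's formula for `c` is built from
      -- both kinds for the elements of `below c`.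
      ↓-↑ᶜ-mem : ∀ c (k : InK c) → Member (↓ (c , k)) × Member (↑ᶜ (c , k))
      ↓-↑ᶜ-mem = Code-induction λ c ih k →
        let open Step c k
            ih′  = λ j → All.lookup ih (∈-lookup j) (proj₂ (y j))
            ⋃↓∈  = ⋃-mem Sub.⊤ {↓ ∘ y} (proj₁ ∘ ih′)
            ⋃↑ᶜ∈ = ⋃-mem Sub.⊤ {↑ᶜ ∘ y} (proj₂ ∘ ih′)
            ↓∈   = Member-resp ((λ {x} → Φ⊆↓ (proj₁ x) (proj₂ x)) , λ {x} → ↓⊆Φ {x})
                     (∧-mem (⋂-mem (val c) generator-mem)
                       (⇨-mem (∨-mem (⋃-mem (∁ (val c)) generator-mem) ⋃↑ᶜ∈) ⋃↓∈))
        in ↓∈ , Member-resp ⇨≐↑ᶜ (⇨-mem ↓∈ (Member-resp {⋃↓} {↧ (c , k)} ⋃↓≐↧ ⋃↓∈))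

      ↓-mem : ∀ p → Member (↓ p)
      ↓-mem (c , k) = proj₁ (↓-↑ᶜ-mem c k)

      ↧-mem : ∀ p → Member (↧ p)
      ↧-mem (c , k) = Member-resp {⋃ Sub.⊤ (↓ ∘ Step.y c k)} {↧ (c , k)} (Step.⋃↓≐↧ c k)
        (⋃-mem Sub.⊤ λ j → ↓-mem (Step.y c k j))

-- Punching out a missed value would leave an injection into a smaller finite set.
injective⇒surjective : ∀ {m} (f : Fin m → Fin m) → (∀ {i j} → f i ≡ f j → i ≡ j) →
                       ∀ k → ∃ λ i → f i ≡ k
injective⇒surjective {suc m} f inj k = decidable-stable (Finₚ.any? λ i → f i Finₚ.≟ k) λ ¬hit →
  let k≢f = λ i (e : k ≡ f i) → ¬hit (i , sym e)
  in ℕₚ.<-irrefl refl (Finₚ.injective⇒≤ {f = λ i → punchOut (k≢f i)}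
       λ {i} {j} e → inj (Finₚ.punchOut-injective (k≢f i) (k≢f j) e))

-- Points just above the union of two cones

module _ {n : ℕ} where

  -- These p are the maximum of ↓a ∪ ↓b, if there is one, and the points w_{β,↓a∪↓b}.
  record Over (a b p : Point {n}) : Set where
    field
      left  : proj₁ a ≤ proj₁ p
      right : proj₁ b ≤ proj₁ p
      lower : ∀ {x} → x ∈ below (proj₁ p) → x ≤ proj₁ a ⊎ x ≤ proj₁ b

  -- Disjointness forces both values to be empty. If `p` were not below `q`, then `p` would lie
  -- outside the two cones. So would `q`, being otherwise the maximum of the strict predecessors of
  -- `p` with the same value. Hence both have the two cones as strict predecessors and coincide.
  Over-unique : ∀ {a b} → (∀ i → i Sub.∈ val (proj₁ a) → ¬ i Sub.∈ val (proj₁ b)) →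
                ∀ {p q} → Over a b p → Over a b q → proj₁ p ≤ proj₁ q
  Over-unique {a′@(a , _)} {b′@(b , _)} disj {p′@(p , kp)} {q′@(q , kq)} op oq =
    decidable-stable (p ≤? q) λ p≰q →
      let p∉ : ¬ (p ≤ a ⊎ p ≤ b)
          p∉ = λ m → p≰q (dominates oq {p′} m)
          q∉ : ¬ (q ≤ a ⊎ q ≤ b)
          q∉ = λ m → β≢val (strict op p∉ {q′} m)
                 (λ m′ → dominates oq {_ , InK-≤ (inj₁ m′) kp} (P.lower m′)) val≡
      in p≰q (inj₂ (≈-ext val≡
           (λ {x} m → strict oq q∉ {x , InK-≤ (inj₁ m) kp} (P.lower m))
           (λ {x} m → strict op p∉ {x , InK-≤ (inj₁ m) kq} (Q.lower m))))
    where
    module P = Over op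
    module Q = Over oq
    open Admissible′ (InK-elim kp)
    dominates : ∀ {r} → Over a′ b′ r → ∀ {x : Point} → proj₁ x ≤ a ⊎ proj₁ x ≤ b → proj₁ x ≤ proj₁ r
    dominates {r} o (inj₁ l) = ≤-trans (proj₂ r) l (Over.left o)
    dominates {r} o (inj₂ l) = ≤-trans (proj₂ r) l (Over.right o)
    strict : ∀ {r} → Over a′ b′ r → ¬ (proj₁ r ≤ a ⊎ proj₁ r ≤ b) →
             ∀ {x : Point} → proj₁ x ≤ a ⊎ proj₁ x ≤ b → proj₁ x ∈ below (proj₁ r)
    strict {r} o r∉ {x} m with dominates o {x} m
    ... | inj₁ k = k
    ... | inj₂ e = ⊥-elim (r∉ ([ inj₁ ∘ ≤-respˡ (≈-sym e) , inj₂ ∘ ≤-respˡ (≈-sym e) ]′ m))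
    no-val : ∀ {r} → Over a′ b′ r → ∀ {i} → ¬ i Sub.∈ val (proj₁ r)
    no-val {r} o {i} i∈ =
      disj i (val-antitone (proj₂ r) (Over.left o) i∈) (val-antitone (proj₂ r) (Over.right o) i∈)
    val≡ : val p ≡ val q
    val≡ = Subₚ.⊆-antisym (λ i∈ → ⊥-elim (no-val op i∈)) (λ i∈ → ⊥-elim (no-val oq i∈))

  -- The point of empty value on top of the two cones always exists, because every value in the
  -- cones contains `i`. A second point is the larger of `a` and `b` if they are comparable; if not,
  -- the cones have no common maximum and value `⁅ i ⁆` is admissible too.
  Over-two : ∀ {a b} i → i Sub.∈ val (proj₁ a) → i Sub.∈ val (proj₁ b) →
             ∃₂ λ p q → Over a b p × Over a b q × ¬ proj₁ p ≤ proj₁ q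
  Over-two {a′@(a , ka)} {b′@(b , kb)} i i∈a i∈b = choose (a ≤? b) (b ≤? a)
    where
    Y : List (Code n)
    Y = (a ∷ below a) ++ (b ∷ below b)

    ∈Y⁻ : ∀ {x} → x ∈ Y → x ≤ a ⊎ x ≤ b
    ∈Y⁻ m with Anyₚ.++⁻ (a ∷ below a) m
    ... | inj₁ (here e)  = inj₁ (inj₂ e)
    ... | inj₁ (there k) = inj₁ (inj₁ k)
    ... | inj₂ (here e)  = inj₂ (inj₂ e)
    ... | inj₂ (there k) = inj₂ (inj₁ k)

    ∈Y⁺ : ∀ {x} → x ≤ a ⊎ x ≤ b → x ∈ Y
    ∈Y⁺ (inj₁ (inj₂ e)) = Anyₚ.++⁺ˡ {xs = a ∷ below a} (here e)
    ∈Y⁺ (inj₁ (inj₁ k)) = Anyₚ.++⁺ˡ {xs = a ∷ below a} (there k)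
    ∈Y⁺ (inj₂ (inj₂ e)) = Anyₚ.++⁺ʳ (a ∷ below a) (here e)
    ∈Y⁺ (inj₂ (inj₁ k)) = Anyₚ.++⁺ʳ (a ∷ below a) (there k)

    i∈Y : ∀ {y} → y ∈ Y → i Sub.∈ val y
    i∈Y m with ∈Y⁻ m
    ... | inj₁ l = val-antitone ka l i∈a
    ... | inj₂ l = val-antitone kb l i∈b

    build : ∀ β → β Sub.⊆ ⁅ i ⁆ → (∀ {y} → y ∈ Y → (∀ {x} → x ∈ Y → x ≤ y) → β ≢ val y) →
            InK (w β Y)
    build β β⊆ β≢ = InK-intro record
      { Y⊆K        = tabulate∈ Y λ m → [ (λ l → InK-≤ l ka) , (λ l → InK-≤ l kb) ]′ (∈Y⁻ m)
      ; decreasing = λ l m → ∈Y⁺ ([ inj₁ ∘ ≤-trans ka l , inj₂ ∘ ≤-trans kb l ]′ (∈Y⁻ m))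
      ; β⊆val      = λ {y} m j∈ →
          subst (Sub._∈ val y) (sym (Subₚ.x∈⁅y⁆⇒x≡y i (β⊆ j∈))) (i∈Y m)
      ; β≢val      = β≢
      }

    over : ∀ {β} (k : InK (w β Y)) → Over a′ b′ (w β Y , k)
    over k = record
      { left  = inj₁ (∈Y⁺ (inj₁ (≤-refl a)))
      ; right = inj₁ (∈Y⁺ (inj₂ (≤-refl b)))
      ; lower = ∈Y⁻
      }

    bottom : Point
    bottom = w Sub.⊥ Y , build Sub.⊥ Subₚ.⊥⊆ λ m _ e → Subₚ.∉⊥ (subst (i Sub.∈_) (sym e) (i∈Y m))

    bottom≰ : ∀ {x} → x ∈ Y → ¬ proj₁ bottom ≤ x
    bottom≰ {x} m l = ∉-below (proj₁ bottom) (≈-refl _) (below-down (proj₂ bottom) l m)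

    choose : Dec (a ≤ b) → Dec (b ≤ a) →
             ∃₂ λ p q → Over a′ b′ p × Over a′ b′ q × ¬ proj₁ p ≤ proj₁ q
    choose (yes a≤b) _ = bottom , b′ , over (proj₂ bottom) ,
      record { left = a≤b ; right = ≤-refl b ; lower = λ m → inj₂ (inj₁ m) } ,
      bottom≰ (∈Y⁺ (inj₂ (≤-refl b)))
    choose (no _) (yes b≤a) = bottom , a′ , over (proj₂ bottom) ,
      record { left = ≤-refl a ; right = b≤a ; lower = λ m → inj₁ (inj₁ m) } ,
      bottom≰ (∈Y⁺ (inj₁ (≤-refl a)))
    choose (no a≰b) (no b≰a) = bottom , (w ⁅ i ⁆ Y , k) , over (proj₂ bottom) , over k , λ where
        (inj₁ m) → bottom≰ m (≤-refl _)
        (inj₂ e) → Subₚ.∉⊥ (subst (i Sub.∈_) (sym (val-cong e)) (Subₚ.x∈⁅x⁆ i))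
      where
      k : InK (w ⁅ i ⁆ Y)
      k = build ⁅ i ⁆ id λ {y} m g _ →
        [ (λ y≤a → b≰a (≤-trans ka (g (∈Y⁺ (inj₂ (≤-refl b)))) y≤a))
        , (λ y≤b → a≰b (≤-trans kb (g (∈Y⁺ (inj₁ (≤-refl a)))) y≤b))
        ]′ (∈Y⁻ m)

  -- These minimal points instantiate the `e i` when the definition is checked at the true
  -- generators.
  atom : Fin n → Point
  atom i = w ⁅ i ⁆ [] , InK-intro record
    { Y⊆K = [] ; decreasing = λ _ () ; β⊆val = λ () ; β≢val = λ () }

-- A formula defining the generators up to a permutation

infix 4 _≤̇_

_≤̇_ : ∀ {k} → Term k → Term k → Formula k
s ≤̇ t = s ⊓̇ t ≐̇ s

not : ∀ {k} → Formula k → Formula k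
not φ = φ implies falsum

⋀ : ∀ {k m} → (Fin m → Formula k) → Formula k
⋀ {m = zero}  φ = not falsum
⋀ {m = suc _} φ = φ zero and ⋀ (φ ∘ suc)

unless : ∀ {k} {P : Set} → Dec P → Formula k → Formula k
unless (yes _) φ = not falsum
unless (no _)  φ = φ

v0 v1 : ∀ {k} → Fin (suc (suc k))
v0 = zero
v1 = suc zero

-- x is the principal down-set of a point and b its set of strict predecessors.
point : ∀ {k} → Fin k → Fin k → Formula k
point x b =
  (var b ≤̇ var x) and not (var x ≤̇ var b) and
  forAll (var zero ≤̇ var (suc x) implies not (var (suc x) ≤̇ var zero) implies
          var zero ≤̇ var (suc b))

-- First-order counterpart of `Over`, with `b` naming the strict predecessors of the point behind
-- `p`.
over : ∀ {k} → Fin k → Fin k → Fin k → Fin k → Formula k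
over x y p b = point p b and (var b ≤̇ var x ⊔̇ var y) and (var x ⊔̇ var y ≤̇ var p)

-- For principal x and y this says that the values of their generating points are
-- disjoint (Over-unique, Over-two).  It is a negative formula because a p satisfying
-- `point p b` need not constructively come from an actual point of K_n.
disjoint : ∀ {k} → Fin k → Fin k → Formula k
disjoint x y = forAll (forAll (forAll (forAll
  (over (4↑ x) (4↑ y) (suc (suc v1)) (suc (suc v0)) implies
   over (4↑ x) (4↑ y) v1 v0 implies
   not (not (var (suc (suc v1)) ≤̇ var v1))))))
  where
  4↑ : ∀ {k} → Fin k → Fin (suc (suc (suc (suc k))))
  4↑ i = suc (suc (suc (suc i)))

-- The constructive disjunction in this formula lets us compute from a prime e
-- below the union of the g_j an index j with e below g_j.
prime : ∀ {k} → Fin k → Formula k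
prime e = forAll (forAll
  (var (suc (suc e)) ≤̇ var v1 ⊔̇ var v0 implies
   var (suc (suc e)) ≤̇ var v1 or var (suc (suc e)) ≤̇ var v0))

-- If e is the principal down-set of a point of value {P_i}, this forces h to be g_i.
marks : ∀ {k} → Fin k → Fin k → Formula k
marks h e = forAll (forAll
  (point v1 v0 implies
    (var v1 ≤̇ var (suc (suc h)) implies not (disjoint v1 (suc (suc e)))) and
    (not (disjoint v1 (suc (suc e))) implies var v1 ≤̇ var (suc (suc h)))))

-- A point has non-empty value exactly if its value is not disjoint from itself; hence the conjunct
-- `not (disjoint (e i) (e i))`.
generators : ∀ {k n} → (Fin n → Fin k) → (Fin n → Fin k) → Formula k
generators e h =
  ⋀ (λ i → exists (point (suc (e i)) zero) and prime (e i) and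
           not (disjoint (e i) (e i)) and marks (h i) (e i)) and
  ⋀ (λ i → ⋀ λ j → unless (i Finₚ.≟ j) (disjoint (e i) (e j)))

-- Meaning of the formulas in a subalgebra containing the generators

module _ {c ℓ₁ ℓ₂ : Level} (A : HeytingAlgebra c ℓ₁ ℓ₂) where

  private module A = HeytingAlgebra A

  ⋀-intro : ∀ {k m} {φ : Fin m → Formula k} {ρ} → (∀ i → A ⊨ φ i [ ρ ]) → A ⊨ ⋀ φ [ ρ ]
  ⋀-intro {m = zero}  f = id
  ⋀-intro {m = suc _} f = f zero , ⋀-intro (f ∘ suc)

  ⋀-elim : ∀ {k m} {φ : Fin m → Formula k} {ρ} → A ⊨ ⋀ φ [ ρ ] → ∀ i → A ⊨ φ i [ ρ ]
  ⋀-elim (p , _) zero    = p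
  ⋀-elim (_ , q) (suc i) = ⋀-elim q i

  unless-intro : ∀ {k} {P : Set} (P? : Dec P) {φ : Formula k} {ρ} →
                 (¬ P → A ⊨ φ [ ρ ]) → A ⊨ unless P? φ [ ρ ]
  unless-intro (yes _) f = id
  unless-intro (no ¬p) f = f ¬p

  unless-elim : ∀ {k} {P : Set} (P? : Dec P) {φ : Formula k} {ρ} →
                ¬ P → A ⊨ unless P? φ [ ρ ] → A ⊨ φ [ ρ ]
  unless-elim (yes p) ¬p _ = ⊥-elim (¬p p)
  unless-elim (no _)  _  h = h

module _ {n : ℕ} {ℓ : Level} (S : Subalgebra (𝓕̂ n) ℓ)
         (generator-mem : ∀ i → Subalgebra.Member S (generator n i)) where

  open DownSet

  private
    A = algebra (𝓕̂ n) S
    module A = HeytingAlgebra A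

  ⟪_⟫ : A.Carrier → Pred (Point {n}) 0ℓ
  ⟪ a ⟫ = mem (proj₁ a)

  ↓ˢ ↧ˢ : Point → A.Carrier
  ↓ˢ p = ↓ p , ↓-mem S generator-mem p
  ↧ˢ p = ↧ p , ↧-mem S generator-mem p

  generatorˢ : Fin n → A.Carrier
  generatorˢ i = generator n i , generator-mem i

  infix 4 _⊑_

  -- Lookups in environments compute, so these agree by definition with the same formulas evaluated
  -- in any longer environment.
  _⊑_ IsPoint Disjoint Marks : A.Carrier → A.Carrier → Set _
  a ⊑ b        = A ⊨ var v0 ≤̇ var v1 [ a Env.∷ b Env.∷ Env.[] ]
  IsPoint a b  = A ⊨ point v0 v1 [ a Env.∷ b Env.∷ Env.[] ]
  Disjoint a b = A ⊨ disjoint v0 v1 [ a Env.∷ b Env.∷ Env.[] ]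
  Marks a b    = A ⊨ marks v0 v1 [ a Env.∷ b Env.∷ Env.[] ]

  Prime : A.Carrier → Set _
  Prime a = A ⊨ prime zero [ a Env.∷ Env.[] ]

  ⊑-intro : ∀ a b → ⟪ a ⟫ ⊆ ⟪ b ⟫ → a ⊑ b
  ⊑-intro a b f = lift (proj₁ , λ m → m , f m)

  ⊑-elim : ∀ a b → a ⊑ b → ∀ {u} → ⟪ a ⟫ u → ⟪ b ⟫ u
  ⊑-elim a b (lift (_ , f)) m = proj₂ (f m)

  Falsum : Set _
  Falsum = A ⊨ falsum [ Env.[] ]

  ⊥-lower : ∀ {X : Set} → Falsum → X
  ⊥-lower (lift ())

  infix 4 _represents_

  record _represents_ (a : A.Carrier) (p : Point) : Set where
    constructor cone
    field
      ⊆cone : ∀ {u} → ⟪ a ⟫ u → proj₁ u ≤ proj₁ p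
      cone⊆ : ∀ {u : Point} → proj₁ u ≤ proj₁ p → ⟪ a ⟫ u

  open _represents_

  apex : ∀ {a p} → a represents p → ⟪ a ⟫ p
  apex {p = p} a~p = cone⊆ a~p {p} (≤-refl (proj₁ p))

  ↓-represents : ∀ p → ↓ˢ p represents p
  ↓-represents p = cone id id

  IsPoint-intro : ∀ a b p → a represents p → ⟪ b ⟫ ≐ ⟪ ↧ˢ p ⟫ → IsPoint a b
  IsPoint-intro a b p@(c , _) (cone a⊆ ⊆a) (b⊆ , ⊆b) =
    ⊑-intro b a (λ m → ⊆a (inj₁ (b⊆ m))) ,
    (λ h → ⊥-elim (∉-below c (≈-refl c) (b⊆ (⊑-elim a b h (⊆a {p} (≤-refl c)))))) ,
    λ y y≤a a≰y → ⊑-intro y b λ {u} m →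
      ⊆b (strict y a≰y u m (a⊆ (⊑-elim y a y≤a m)))
    where
    strict : ∀ y → (a ⊑ y → Falsum) →
             ∀ u → ⟪ y ⟫ u → proj₁ u ≤ c → proj₁ u ∈ below c
    strict y a≰y u m (inj₁ l) = l
    strict y a≰y u m (inj₂ e) = ⊥-lower (a≰y (⊑-intro a y λ l →
      down (proj₁ y) {y = u} (≤-respʳ (a⊆ l) (≈-sym e)) m))

  -- If no point `u` of `a` satisfied `a ⊑ ↓ˢ u`, every such cone would be strictly below `a`, hence
  -- below `b`, making `a ⊑ b`. This refutes non-existence without producing a point, hence the
  -- double negation.
  IsPoint-elim : ∀ a b → IsPoint a b → ¬ ¬ ∃ λ p → a represents p × ⟪ b ⟫ ≐ ⟪ ↧ˢ p ⟫
  IsPoint-elim a b (b≤a , a≰b , lower) none =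
    ⊥-lower (a≰b (⊑-intro a b λ {u} m →
      ⊑-elim (↓ˢ u) b
        (lower (↓ˢ u) (↓⊑a m) λ a≤u → ⊥-elim (none (u , represents-u m a≤u , below-u m a≤u)))
        {u} (≤-refl (proj₁ u))))
    where
    ↓⊑a : ∀ {u} → ⟪ a ⟫ u → ↓ˢ u ⊑ a
    ↓⊑a {u} m = ⊑-intro (↓ˢ u) a λ l → down (proj₁ a) l m

    represents-u : ∀ {u} → ⟪ a ⟫ u → a ⊑ ↓ˢ u → a represents u
    represents-u {u} m a≤u = cone (λ {v} → ⊑-elim a (↓ˢ u) a≤u {v}) (λ l → down (proj₁ a) l m)

    below-u : ∀ {u} → ⟪ a ⟫ u → a ⊑ ↓ˢ u → ⟪ b ⟫ ≐ ⟪ ↧ˢ u ⟫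
    below-u {u} m a≤u =
      (λ {v} m′ → strict v m′ (⊑-elim a (↓ˢ u) a≤u {v} (⊑-elim b a b≤a {v} m′))) , above
      where
      strict : ∀ v → ⟪ b ⟫ v → proj₁ v ≤ proj₁ u → proj₁ v ∈ below (proj₁ u)
      strict v m′ (inj₁ l) = l
      strict v m′ (inj₂ e) = ⊥-lower (a≰b (⊑-intro a b λ {x} l →
        down (proj₁ b) (≤-respʳ (⊑-elim a (↓ˢ u) a≤u {x} l) (≈-sym e)) m′))
      above : ⟪ ↧ˢ u ⟫ ⊆ ⟪ b ⟫
      above {v} l = ⊑-elim (↓ˢ v) b
        (lower (↓ˢ v) (↓⊑a {v} (down (proj₁ a) {x = v} {y = u} (inj₁ l) m)) λ a≤v →
          ⊥-elim (∉-below (proj₁ u) (≈-refl _)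
            (below-down (proj₂ u) (⊑-elim a (↓ˢ v) a≤v {u} m) l)))
        {v} (≤-refl (proj₁ v))

  module _ {a b : A.Carrier} {p q : Point} (a~p : a represents p) (b~q : b represents q) where

    Over-intro : ∀ {c d r} → c represents r → ⟪ d ⟫ ≐ ⟪ ↧ˢ r ⟫ →
                 d ⊑ a A.∨ b → a A.∨ b ⊑ c → Over p q r
    Over-intro {c} {d} {r} c~r d~r l u = record
      { left  = ⊆cone c~r (⊑-elim (a A.∨ b) c u (inj₁ (apex a~p)))
      ; right = ⊆cone c~r (⊑-elim (a A.∨ b) c u (inj₂ (apex b~q)))
      ; lower = λ {x} m → let x′ = x , InK-≤ (inj₁ m) (proj₂ r) in
          Sum.map (⊆cone a~p {x′}) (⊆cone b~q {x′}) (⊑-elim d (a A.∨ b) l {x′} (proj₂ d~r m))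
      }

    -- The doubly negated conclusion of `disjoint` lets `IsPoint-elim` extract the points behind `c`
    -- and `c′`, which `Over-unique` compares.
    Disjoint-intro : (∀ i → i Sub.∈ val (proj₁ p) → ¬ i Sub.∈ val (proj₁ q)) → Disjoint a b
    Disjoint-intro disj c d c′ d′ (P , l , u) (P′ , l′ , u′) c≰c′ =
      ⊥-elim (IsPoint-elim c d P λ (r , c~r , d~r) →
        IsPoint-elim c′ d′ P′ λ (r′ , c′~r′ , d′~r′) →
          ⊥-lower (c≰c′ (⊑-intro c c′ λ {x} m →
            cone⊆ c′~r′ {x} (≤-trans (proj₂ r′) (⊆cone c~r m)
              (Over-unique {a = p} {b = q} disj {p = r} {q = r′}
                (Over-intro {c} {d} {r} c~r d~r l u)
                (Over-intro {c′} {d′} {r′} c′~r′ d′~r′ l′ u′))))))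

    Disjoint-elim : ∀ {i} → i Sub.∈ val (proj₁ p) → i Sub.∈ val (proj₁ q) → ¬ Disjoint a b
    Disjoint-elim {i} i∈p i∈q D with Over-two i i∈p i∈q
    ... | r , r′ , o , o′ , r≰r′ =
      ⊥-lower (D (↓ˢ r) (↧ˢ r) (↓ˢ r′) (↧ˢ r′) (over-↓ r o) (over-↓ r′ o′) λ r≤r′ →
        ⊥-elim (r≰r′ (⊑-elim (↓ˢ r) (↓ˢ r′) r≤r′ {r} (≤-refl _))))
      where
      over-↓ : ∀ r → Over p q r → IsPoint (↓ˢ r) (↧ˢ r) × ↧ˢ r ⊑ a A.∨ b × a A.∨ b ⊑ ↓ˢ r
      over-↓ r o =
        IsPoint-intro (↓ˢ r) (↧ˢ r) r (↓-represents r) (id , id) ,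
        ⊑-intro (↧ˢ r) (a A.∨ b) (λ {x} m → Sum.map (cone⊆ a~p {x}) (cone⊆ b~q {x}) (O.lower m)) ,
        ⊑-intro (a A.∨ b) (↓ˢ r) λ where
          (inj₁ m) → ≤-trans (proj₂ r) (⊆cone a~p m) O.left
          (inj₂ m) → ≤-trans (proj₂ r) (⊆cone b~q m) O.right
        where module O = Over o

  Prime-↓ : ∀ p → Prime (↓ˢ p)
  Prime-↓ p x y l with ⊑-elim (↓ˢ p) (x A.∨ y) l {p} (≤-refl _)
  ... | inj₁ m = inj₁ (⊑-intro (↓ˢ p) x λ l → down (proj₁ x) l m)
  ... | inj₂ m = inj₂ (⊑-intro (↓ˢ p) y λ l → down (proj₁ y) l m)

  -- Primality splits off one member of the family at a time; the empty family leaves `a ⊑ A.⊥`.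
  Prime-⋃ : ∀ a → Prime a → ∀ {m} (f : Fin m → A.Carrier) →
            (∀ {u} → ⟪ a ⟫ u → ∃ λ i → ⟪ f i ⟫ u) →
            a ⊑ A.⊥ ⊎ ∃ λ i → a ⊑ f i
  Prime-⋃ a prm {zero} f h = inj₁ (⊑-intro a A.⊥ λ {u} m → case₀ (h {u} m))
    where
    case₀ : ∀ {X : Set} {u} → ∃ (λ (i : Fin zero) → ⟪ f i ⟫ u) → X
    case₀ (() , _)
  Prime-⋃ a prm {suc m} f h =
    [ (λ l → inj₂ (zero , l))
    , (λ l → Sum.map₂ (λ (i , l′) → suc i , l′)
        (Prime-⋃ a prm (f ∘ suc) λ {u} m → let i , _ , m′ = ⊑-elim a rest l {u} m in i , m′))
    ]′ (prm (f zero) rest (⊑-intro a (f zero A.∨ rest) λ {u} m → split (h {u} m)))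
    where
    rest : A.Carrier
    rest = ⋃ Sub.⊤ (proj₁ ∘ f ∘ suc) , ⋃-mem S Sub.⊤ (proj₂ ∘ f ∘ suc)
    split : ∀ {u} → ∃ (λ i → ⟪ f i ⟫ u) → ⟪ f zero ⟫ u ⊎ ⟪ rest ⟫ u
    split (zero , m)  = inj₁ m
    split (suc i , m) = inj₂ (i , Subₚ.∈⊤ , m)

  Mark : A.Carrier → A.Carrier → Set _
  Mark a g = ∃ (λ b → IsPoint a b) × Prime a × (Disjoint a a → Falsum) × Marks g a

  ∈-atom : ∀ (i : Fin n) → i Sub.∈ val (proj₁ (atom i))
  ∈-atom i = Subₚ.x∈⁅x⁆ i

  Mark-atom : ∀ i → Mark (↓ˢ (atom i)) (generatorˢ i)
  Mark-atom i =
    (↧ˢ (atom i) , IsPoint-intro (↓ˢ (atom i)) (↧ˢ (atom i)) (atom i) i~ (id , id)) ,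
    Prime-↓ (atom i) ,
    (λ D → ⊥-elim (Disjoint-elim i~ i~ (∈-atom i) (∈-atom i) D)) ,
    λ a b P →
      (λ a≤g D → ⊥-elim (IsPoint-elim a b P λ (p , a~p , _) →
        Disjoint-elim a~p i~
          (⊑-elim a (generatorˢ i) a≤g {p} (apex a~p)) (∈-atom i) D)) ,
      -- If `val v` lacks `i`, so does the smaller set `val p`, which is then disjoint from `⁅ i ⁆`.
      λ ¬D → ⊑-intro a (generatorˢ i) λ {v} m → decidable-stable (i Subₚ.∈? val (proj₁ v)) λ i∉v →
        IsPoint-elim a b P λ (p , a~p , _) → ⊥-lower (¬D (Disjoint-intro a~p i~ λ j j∈p j∈i →
          i∉v (subst (Sub._∈ val (proj₁ v)) (Subₚ.x∈⁅y⁆⇒x≡y i j∈i)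
            (val-antitone (proj₂ p) (⊆cone a~p {v} m) j∈p))))
    where
    i~ : ↓ˢ (atom i) represents atom i
    i~ = ↓-represents (atom i)

  module _ {k : ℕ} (e h : Fin n → Fin k) (ρ : Vector A.Carrier k) where

    generators-intro : (∀ i → ρ (e i) ≡ ↓ˢ (atom i)) → (∀ i → ρ (h i) ≡ generatorˢ i) →
                       A ⊨ generators e h [ ρ ]
    generators-intro e≡ h≡ =
      ⋀-intro A (λ i → subst₂ Mark (sym (e≡ i)) (sym (h≡ i)) (Mark-atom i)) ,
      ⋀-intro A λ i → ⋀-intro A λ j → unless-intro A (i Finₚ.≟ j) λ i≢j →
        subst₂ Disjoint (sym (e≡ i)) (sym (e≡ j))
          (Disjoint-intro (↓-represents (atom i)) (↓-represents (atom j)) λ l l∈i l∈j →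
            i≢j (trans (sym (Subₚ.x∈⁅y⁆⇒x≡y i l∈i)) (Subₚ.x∈⁅y⁆⇒x≡y j l∈j)))

    module _ (H : A ⊨ generators e h [ ρ ]) where

      private
        mark : ∀ i → Mark (ρ (e i)) (ρ (h i))
        mark = ⋀-elim A (proj₁ H)

        apart : ∀ i j → i ≢ j → Disjoint (ρ (e i)) (ρ (e j))
        apart i j i≢j =
          unless-elim A (i Finₚ.≟ j) i≢j (⋀-elim A (⋀-elim A (proj₂ H) i) j)

        located : ∀ i → ¬ ¬ ∃ λ p → ρ (e i) represents p
        located i none = let (b , P) , _ = mark i in
          IsPoint-elim (ρ (e i)) b P λ (p , e~p , _) → none (p , e~p)

        -- The search for `j` is finite and decidable, which removes the double negation of
        -- `located`. An empty value at `u` would make the value at the apex empty, hence disjoint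
        -- from itself.
        labelled : ∀ i {u} → ⟪ ρ (e i) ⟫ u → ∃ λ j → j Sub.∈ val (proj₁ u)
        labelled i {u} m = decidable-stable (Finₚ.any? λ j → j Subₚ.∈? val (proj₁ u)) λ none →
          located i λ (p , e~p) → let _ , _ , meets , _ = mark i in
            ⊥-lower (meets (Disjoint-intro e~p e~p λ j j∈p _ →
              none (j , val-antitone (proj₂ p) (⊆cone e~p {u} m) j∈p)))

        -- Primality turns the pointwise labels into a single one for all of `ρ (e i)`; the case
        -- `A.⊥` is excluded by the apex.
        label : ∀ i → ∃ λ j → ρ (e i) ⊑ generatorˢ j
        label i with Prime-⋃ (ρ (e i)) (let _ , prm , _ = mark i in prm) generatorˢ
                       (λ {u} m → labelled i {u} m)
        ... | inj₁ l = ⊥-elim (located i λ (p , e~p) →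
          ⊑-elim (ρ (e i)) A.⊥ l {p} (apex e~p))
        ... | inj₂ found = found

        π : Fin n → Fin n
        π i = proj₁ (label i)

        ∈-label : ∀ i {p} → ρ (e i) represents p → π i Sub.∈ val (proj₁ p)
        ∈-label i {p} e~p =
          ⊑-elim (ρ (e i)) (generatorˢ (π i)) (proj₂ (label i)) {p} (apex e~p)

        label-unique : ∀ i j {p} → ρ (e i) represents p → π j Sub.∈ val (proj₁ p) → i ≡ j
        label-unique i j e~p j∈p = decidable-stable (i Finₚ.≟ j) λ i≢j →
          located j λ (q , e~q) → Disjoint-elim e~p e~q j∈p (∈-label j e~q) (apart i j i≢j)

        π-injective : ∀ {i j} → π i ≡ π j → i ≡ j
        π-injective {i} {j} eq = decidable-stable (i Finₚ.≟ j) λ i≢j →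
          located i λ (p , e~p) →
            i≢j (label-unique i j e~p (subst (Sub._∈ val (proj₁ p)) eq (∈-label i e~p)))

        -- There are as many `e i` as symbols, so injective labelling uses every symbol.
        π-surjective : ∀ k → ∃ λ i → π i ≡ k
        π-surjective = injective⇒surjective π π-injective

        -- The apex of `ρ (e i)` has value exactly `⁅ π i ⁆`: any symbol in it is some `π j`, and
        -- then `label-unique` gives `i ≡ j`. So `marks`, applied to each cone `↓ˢ u`, decides
        -- membership of `u` by whether `π i` is in its value.
        h≐g : ∀ i → ⟪ ρ (h i) ⟫ ≐ ⟪ generatorˢ (π i) ⟫
        h≐g i =
          (λ {u} m → decidable-stable (π i Subₚ.∈? val (proj₁ u)) λ πi∉u →
            ⊥-lower (proj₁ (marks-↓ u) (⊑-intro (↓ˢ u) (ρ (h i)) λ l → down (proj₁ (ρ (h i))) l m)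
              (disjoint-↓ u πi∉u))) ,
          λ {u} πi∈u → ⊑-elim (↓ˢ u) (ρ (h i))
            (proj₂ (marks-↓ u) λ D → ⊥-elim (located i λ (p , e~p) →
              Disjoint-elim (↓-represents u) e~p πi∈u (∈-label i e~p) D))
            {u} (≤-refl _)
          where
          marks-↓ : ∀ u → (↓ˢ u ⊑ ρ (h i) → Disjoint (↓ˢ u) (ρ (e i)) → Falsum) ×
                          ((Disjoint (↓ˢ u) (ρ (e i)) → Falsum) → ↓ˢ u ⊑ ρ (h i))
          marks-↓ u = let _ , _ , _ , M = mark i in
            M (↓ˢ u) (↧ˢ u) (IsPoint-intro (↓ˢ u) (↧ˢ u) u (↓-represents u) (id , id))
          disjoint-↓ : ∀ u → ¬ π i Sub.∈ val (proj₁ u) → Disjoint (↓ˢ u) (ρ (e i))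
          -- `disjoint` is unfolded down to `Falsum`, where the double negation of `located` can be
          -- discharged.
          disjoint-↓ u πi∉u c d c′ d′ o o′ c≰c′ = ⊥-elim (located i λ (p , e~p) →
            ⊥-lower (Disjoint-intro (↓-represents u) e~p (λ k k∈u k∈p →
              let j , πj≡k = π-surjective k
                  i≡j      = label-unique i j e~p (subst (Sub._∈ val (proj₁ p)) (sym πj≡k) k∈p)
              in πi∉u (subst (Sub._∈ val (proj₁ u)) (trans (sym πj≡k) (cong π (sym i≡j))) k∈u))
              c d c′ d′ o o′ c≰c′))

      generators-elim : ∃₂ λ (π σ : Fin n → Fin n) →
                        (∀ i → π (σ i) ≡ i) × (∀ i → σ (π i) ≡ i) ×
                        (∀ i → ρ (h i) A.≈ generatorˢ (π i))
      generators-elim = π , proj₁ ∘ π-surjective , proj₂ ∘ π-surjective ,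
        (λ i → π-injective (proj₂ (π-surjective (π i)))) , h≐g

-- Automorphisms induced by relabelling

module _ {n : ℕ} (π σ : Fin n → Fin n) (πσ : ∀ i → π (σ i) ≡ i) (σπ : ∀ i → σ (π i) ≡ i) where

  open DownSet

  relabelPoint : Point {n} → Point {n}
  relabelPoint (x , k) = relabel π x , relabel-InK π σ πσ σπ x k

  preimage : DownSet (K n) → DownSet (K n)
  preimage a = record
    { mem  = λ x → mem a (relabelPoint x)
    ; down = λ {x} {y} l → down a {relabelPoint x} {relabelPoint y} (relabel-≤ π l) }

module Relabelling {n : ℕ} (π σ : Fin n → Fin n)
                   (πσ : ∀ i → π (σ i) ≡ i) (σπ : ∀ i → σ (π i) ≡ i) where

  open DownSet
  private module 𝓕̂ = HeytingAlgebra (𝓕̂ n)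

  r s : Point {n} → Point {n}
  r = relabelPoint π σ πσ σπ
  s = relabelPoint σ π σπ πσ

  _⋆ _⋆⁻¹ : DownSet (K n) → DownSet (K n)
  _⋆   = preimage π σ πσ σπ
  _⋆⁻¹ = preimage σ π σπ πσ

  rs : ∀ x → proj₁ (r (s x)) ≈ proj₁ x
  rs (x , _) = subst (_≈ x) (sym (relabel-inverse σ π σπ x)) (≈-refl x)

  sr : ∀ x → proj₁ (s (r x)) ≈ proj₁ x
  sr (x , _) = subst (_≈ x) (sym (relabel-inverse π σ πσ x)) (≈-refl x)

  ⋆⁻¹⋆ : ∀ a → (a ⋆⁻¹) ⋆ 𝓕̂.≈ a
  ⋆⁻¹⋆ a = (λ {x} → down a {x} {s (r x)} (inj₂ (≈-sym (sr x)))) ,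
           (λ {x} → down a {s (r x)} {x} (inj₂ (sr x)))

  ⋆-reflects : ∀ a b → mem (a ⋆) ⊆ mem (b ⋆) → mem a ⊆ mem b
  ⋆-reflects a b f {x} m =
    down b {x} {r (s x)} (inj₂ (≈-sym (rs x)))
      (f {s x} (down a {r (s x)} {x} (inj₂ (rs x)) m))

  -- Implication ranges over all points below, so the right-to-left inclusion uses that every such
  -- point `v` is, up to `≈`, of the form `r (s v)`.
  ⋆-⇨ : ∀ a b → (a 𝓕̂.⇨ b) ⋆ 𝓕̂.≈ (a ⋆) 𝓕̂.⇨ (b ⋆)
  ⋆-⇨ a b =
    (λ f {v} l m → f {r v} (relabel-≤ π l) m) ,
    (λ {x} f {v} l m →
      down b {v} {r (s v)} (inj₂ (≈-sym (rs v)))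
        (f {s v} (≤-respʳ (relabel-≤ σ l) (sr x))
          (down a {r (s v)} {v} (inj₂ (rs v)) m)))

  generator-⋆ : ∀ i → generator n i ⋆ 𝓕̂.≈ generator n (π i)
  generator-⋆ i =
    (λ {x} m → ∈-pull⁻ π (subst (i Sub.∈_) (val-relabel π (proj₁ x)) m)) ,
    (λ {x} m → subst (i Sub.∈_) (sym (val-relabel π (proj₁ x))) (∈-pull⁺ π m))

  automorphism : ∀ {p} (S : Subalgebra (𝓕̂ n) p) →
                 (∀ {a} → Subalgebra.Member S a → Subalgebra.Member S (a ⋆)) →
                 (∀ {a} → Subalgebra.Member S a → Subalgebra.Member S (a ⋆⁻¹)) →
                 Isomorphism (algebra (𝓕̂ n) S) (algebra (𝓕̂ n) S)
  automorphism S ⋆-mem ⋆⁻¹-mem = record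
    { to         = λ (a , m) → a ⋆ , ⋆-mem m
    ; to-cong    = λ (f , g) → (λ m → f m) , (λ m → g m)
    ; injective  = λ {(a , _)} {(b , _)} (f , g) →
                     ⋆-reflects a b (λ {x} → f {x}) , ⋆-reflects b a (λ {x} → g {x})
    ; surjective = λ (b , m) → (b ⋆⁻¹ , ⋆⁻¹-mem m) , ⋆⁻¹⋆ b
    ; ⊤-homo     = id , id
    ; ⊥-homo     = id , id
    ; ∧-homo     = λ _ _ → id , id
    ; ∨-homo     = λ _ _ → id , id
    ; ⇨-homo     = λ (a , _) (b , _) → ⋆-⇨ a b
    }

  Generated-⋆ : ∀ {a} → Generated (𝓕̂ n) (generator n) a → Generated (𝓕̂ n) (generator n) (a ⋆)
  Generated-⋆ (gen i) =
    resp (𝓕̂.Eq.sym {generator n i ⋆} {generator n (π i)} (generator-⋆ i)) (gen (π i))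
  Generated-⋆ (resp (f , g) a) = resp ((λ m → f m) , (λ m → g m)) (Generated-⋆ a)
  Generated-⋆ top              = resp (id , id) top
  Generated-⋆ bot              = resp (id , id) bot
  Generated-⋆ (meet a b)       = resp (id , id) (meet (Generated-⋆ a) (Generated-⋆ b))
  Generated-⋆ (join a b)       = resp (id , id) (join (Generated-⋆ a) (Generated-⋆ b))
  Generated-⋆ (impl {a} {b} p q) =
    resp (𝓕̂.Eq.sym {(a 𝓕̂.⇨ b) ⋆} {(a ⋆) 𝓕̂.⇨ (b ⋆)} (⋆-⇨ a b))
         (impl (Generated-⋆ p) (Generated-⋆ q))

-- Reduction of formulas with parameters to sentences

record Invariant {n : ℕ} {p : Level} (S : Subalgebra (𝓕̂ n) p) : Set (lsuc 0ℓ ⊔ p) where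
  open Subalgebra S
  field
    generator-mem : ∀ i → Member (generator n i)
    preimage-mem  : ∀ π σ πσ σπ {a} → Member a → Member (preimage π σ πσ σπ a)

𝓕-invariant : ∀ n → Invariant (𝓕 n)
𝓕-invariant n = record
  { generator-mem = gen
  ; preimage-mem  = λ π σ πσ σπ → Relabelling.Generated-⋆ π σ πσ σπ
  }

-- Viewing `𝓕̂ n` as a subalgebra of itself lets one argument about invariant subalgebras serve both
-- algebras.
total : ∀ n → Subalgebra (𝓕̂ n) 0ℓ
total n = record
  { Member = U ; resp = λ _ _ → _ ; ⊤-mem = _ ; ⊥-mem = _
  ; ∧-mem = λ _ _ → _ ; ∨-mem = λ _ _ → _ ; ⇨-mem = λ _ _ → _ }

total-invariant : ∀ n → Invariant (total n)
total-invariant n = record { generator-mem = λ _ → _ ; preimage-mem = λ _ _ _ _ _ → _ }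

total≅ : ∀ n → Isomorphism (algebra (𝓕̂ n) (total n)) (𝓕̂ n)
total≅ n = record
  { to         = proj₁
  ; to-cong    = id
  ; injective  = id
  ; surjective = λ a → (a , _) , id , id
  ; ⊤-homo     = id , id
  ; ⊥-homo     = id , id
  ; ∧-homo     = λ _ _ → id , id
  ; ∨-homo     = λ _ _ → id , id
  ; ⇨-homo     = λ _ _ → id , id
  }

-- Of the `n + n` quantified variables the first half are the auxiliary points `e`, the second half
-- the candidates `h` at which the terms are evaluated.
atGenerators : ∀ {k} n → (Fin k → Term n) → Formula k → Sentence
atGenerators n t φ = existsAll {n + n}
  (generators (_↑ˡ n) (n ↑ʳ_) and substFormula (λ i → substTerm (var ∘ (n ↑ʳ_)) (t i)) φ)

module _ {n : ℕ} {p : Level} (S : Subalgebra (𝓕̂ n) p) (inv : Invariant S) where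

  open Invariant inv
  private
    A = algebra (𝓕̂ n) S
    module A = HeytingAlgebra A

  values : ∀ {k} → (Fin k → Term n) → Vector A.Carrier k
  values t i = ⟦_⟧ A (t i) (generatorˢ S generator-mem)

  -- Forwards, the atoms and the true generators are witnesses. Backwards, arbitrary witnesses are
  -- the generators permuted, and an automorphism undoes the permutation.
  ⊨-atGenerators : ∀ {k} (t : Fin k → Term n) (φ : Formula k) →
                   A ⊨ φ [ values t ] ⇔ A ⊨ atGenerators n t φ [ Env.[] ]
  ⊨-atGenerators t φ = mk⇔ to from
    where
    e h : Fin n → Fin (n + n)
    e = _↑ˡ n
    h = n ↑ʳ_
    g = generatorˢ S generator-mem
    Θ = generators e h and substFormula (λ i → substTerm (var ∘ h) (t i)) φ
    module Θ = Equivalence (⊨-existsAll A Θ)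

    instantiated : ∀ ρ → A ⊨ substFormula (λ i → substTerm (var ∘ h) (t i)) φ [ ρ ] ⇔
                         A ⊨ φ [ (λ i → ⟦_⟧ A (t i) (ρ ∘ h)) ]
    instantiated ρ = ⊨-subst A (λ i → substTerm (var ∘ h) (t i)) φ
      λ i → A.Eq.reflexive (⟦substTerm⟧ A (var ∘ h) (t i))

    to : A ⊨ φ [ values t ] → A ⊨ atGenerators n t φ [ Env.[] ]
    to p = Θ.from (ρ ,
      generators-intro S generator-mem e h ρ
        (Envₚ.lookup-++ˡ atoms g) (Envₚ.lookup-++ʳ atoms g) ,
      Equivalence.from (instantiated ρ) (⊨-reflected (identity A) φ
        (λ i → ⟦⟧-homo (identity A) (t i) λ j → A.Eq.reflexive (Envₚ.lookup-++ʳ atoms g j)) p))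
      where
      atoms : Vector A.Carrier n
      atoms i = ↓ˢ S generator-mem (atom i)
      ρ : Vector A.Carrier (n + n)
      ρ = atoms Env.++ g

    from : A ⊨ atGenerators n t φ [ Env.[] ] → A ⊨ φ [ values t ]
    from q =
      let ρ , H , p = Θ.to q
          π , σ , πσ , σπ , h≈g = generators-elim S generator-mem e h ρ H
      in relabelled π σ πσ σπ ρ h≈g p
      where
      relabelled : ∀ π σ πσ σπ ρ → (∀ i → ρ (h i) A.≈ g (π i)) →
                   A ⊨ substFormula (λ i → substTerm (var ∘ h) (t i)) φ [ ρ ] →
                   A ⊨ φ [ values t ]
      relabelled π σ πσ σπ ρ h≈g p =
        -- The automorphism sends `g j` to `g (π j)`, which is `ρ (h j)`, so it takes `values t` to
        -- the values of `t` at the witnesses.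
        ⊨-reflected ⋆-iso φ
          (λ i → ⟦⟧-homo ⋆-iso (t i) λ j →
            A.Eq.trans {g j .proj₁ ⋆ , preimage-mem π σ πσ σπ (g j .proj₂)} {g (π j)} {ρ (h j)}
              (generator-⋆ j) (A.Eq.sym {ρ (h j)} {g (π j)} (h≈g j)))
          (Equivalence.to (instantiated ρ) p)
        where
        open Relabelling π σ πσ σπ
        ⋆-iso : Isomorphism A A
        ⋆-iso = automorphism S (preimage-mem π σ πσ σπ) (preimage-mem σ π σπ πσ)

  ⟦⟧-proj₁ : ∀ {k} (t : Term k) (ρ : Vector A.Carrier k) →
             proj₁ (⟦_⟧ A t ρ) ≡ ⟦_⟧ (𝓕̂ n) t (proj₁ ∘ ρ)
  ⟦⟧-proj₁ (var i) ρ = refl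
  ⟦⟧-proj₁ 0̇       ρ = refl
  ⟦⟧-proj₁ 1̇       ρ = refl
  ⟦⟧-proj₁ (s ⊓̇ t) ρ = cong₂ (HeytingAlgebra._∧_ (𝓕̂ n)) (⟦⟧-proj₁ s ρ) (⟦⟧-proj₁ t ρ)
  ⟦⟧-proj₁ (s ⊔̇ t) ρ = cong₂ (HeytingAlgebra._∨_ (𝓕̂ n)) (⟦⟧-proj₁ s ρ) (⟦⟧-proj₁ t ρ)
  ⟦⟧-proj₁ (s →̇ t) ρ = cong₂ (HeytingAlgebra._⇨_ (𝓕̂ n)) (⟦⟧-proj₁ s ρ) (⟦⟧-proj₁ t ρ)

-- Parameters as terms, and transfer between the two algebras

module _ {c ℓ₁ ℓ₂ : Level} (H : HeytingAlgebra c ℓ₁ ℓ₂) where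

  private module H = HeytingAlgebra H

  Generated⇒term : ∀ {n a} {g : Fin n → H.Carrier} → Generated H g a → ∃ λ t → ⟦_⟧ H t g H.≈ a
  Generated⇒term (gen i)    = var i , H.Eq.refl
  Generated⇒term (resp e p) = let t , f = Generated⇒term p in t , H.Eq.trans f e
  Generated⇒term top        = 1̇ , H.Eq.refl
  Generated⇒term bot        = 0̇ , H.Eq.refl
  Generated⇒term (meet p q) =
    let s , e = Generated⇒term p ; t , f = Generated⇒term q
    in s ⊓̇ t , MS.∧-cong H.meetSemilattice e f
  Generated⇒term (join p q) =
    let s , e = Generated⇒term p ; t , f = Generated⇒term q
    in s ⊔̇ t , JS.∨-cong H.joinSemilattice e f
  Generated⇒term (impl p q) =
    let s , e = Generated⇒term p ; t , f = Generated⇒term q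
    in s →̇ t , HA.⇨-cong H e f

proposition6p9 : (n : ℕ) → n ≥ 1 →
    ElementarilyEquivalent (algebra (𝓕̂ n) (𝓕 n)) (𝓕̂ n) →
    ElementarySubstructure (𝓕̂ n) (𝓕 n)
proposition6p9 n _ equiv {k} φ ρ = mk⇔
  -- Each direction turns `φ` at the parameters into the sentence `Θ` within one algebra, crosses
  -- over by `equiv`, and turns `Θ` back into `φ` in the other.
  (λ p → ⊨-preserved (total≅ n) φ ρ̂↝
    (Θ̂.from (⊨-reflected (total≅ n) Θ {σ = Env.[]} (λ ())
      (Equivalence.to (equiv Θ) (Θ₀.to (⊨-preserved (identity A) φ ρ↝ p))))))
  (λ p → ⊨-reflected (identity A) φ ρ↝
    (Θ₀.from (Equivalence.from (equiv Θ)
      (⊨-preserved (total≅ n) Θ {ρ = Env.[]} (λ ())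
        (Θ̂.to (⊨-reflected (total≅ n) φ ρ̂↝ p))))))
  where
  module 𝓕̂ = HeytingAlgebra (𝓕̂ n)
  A = algebra (𝓕̂ n) (𝓕 n)

  -- The parameters lie in the generated subalgebra. The same terms express them in both algebras,
  -- so a single sentence serves for both.
  t : Fin k → Term n
  t i = proj₁ (Generated⇒term (𝓕̂ n) (proj₂ (ρ i)))

  Θ : Sentence
  Θ = atGenerators n t φ

  module _ {p : Level} (S : Subalgebra (𝓕̂ n) p) (inv : Invariant S) where

    values≈ρ : ∀ i → proj₁ (values S inv t i) 𝓕̂.≈ proj₁ (ρ i)
    values≈ρ i = 𝓕̂.Eq.trans {v} {v̂} {proj₁ (ρ i)}
      (𝓕̂.Eq.reflexive {v} {v̂} (⟦⟧-proj₁ S inv (t i) _))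
      (proj₂ (Generated⇒term (𝓕̂ n) (proj₂ (ρ i))))
      where
      v = proj₁ (values S inv t i)
      v̂ = ⟦_⟧ (𝓕̂ n) (t i) (generator n)

  ρ↝ : ∀ i → HeytingAlgebra._≈_ A (ρ i) (values (𝓕 n) (𝓕-invariant n) t i)
  ρ↝ i = HeytingAlgebra.Eq.sym A {values (𝓕 n) (𝓕-invariant n) t i} {ρ i}
    (values≈ρ (𝓕 n) (𝓕-invariant n) i)

  ρ̂↝ : ∀ i → proj₁ (values (total n) (total-invariant n) t i) 𝓕̂.≈ proj₁ (ρ i)
  ρ̂↝ = values≈ρ (total n) (total-invariant n)

  module Θ₀ = Equivalence (⊨-atGenerators (𝓕 n) (𝓕-invariant n) t φ)
  module Θ̂  = Equivalence (⊨-atGenerators (total n) (total-invariant n) t φ)
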